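{- Let $C \subset \mathbb{S}^{47}$ be a spherical $11$-design whose set of inner products $I(C)=\{\langle x,y\rangle : x,y\in C,\ x\neq y\}$ satisfies $I(C) \subset [-1,1)\setminus F$, where $F=\left(-\tfrac13,-\tfrac16\right)\cup\left(\tfrac16,\tfrac13\right)$. Then $|C| \geq 52\,416\,000$. If equality holds, then $C$ is distance invariant and its distance distribution is \[ A_{ -1}=1,\quad A_{1/2}=A_{ -1/2}=36\,848,\quad A_{1/3}=A_{ -1/3}=1\,678\,887,\quad A_{1/6}=A_{ -1/6}=12\,608\,784,\quad A_0=23\,766\,960 \] (with $A_t=0$ for all other $t$).
   Context: A spherical $\tau$-design is a finite set $C\subset\mathbb{S}^{n-1}$ such that $\int_{\mathbb{S}^{n-1}} p\, d\sigma_n = \frac{1}{|C|}\sum_{x\in C} p(x)$ for every polynomial $p$ in $n$ variables of degree at most $\tau$, where $\sigma_n$ is the normalized surface measure. For $x\in C$ and $t\in[-1,1)$, $A_t(x)=|\{y\in C: \langle x,y\rangle = t\}|$; $C$ is distance invariant if $A_t(x)$ does not depend on $x\in C$ for every $t$, and then one writes $A_t$. -}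

module Defs where

open import Algebra.Bundles using (CommutativeRing; CommutativeMonoid)
import Algebra.Definitions.RawMonoid as RawMonoidDefs
import Algebra.Properties.Semiring.Exp as Exp
open import Data.Fin.Base using (Fin; toℕ)
open import Data.List.Base using (List; length; filter; allFin; foldr)
open import Data.Nat.Base as ℕ using (ℕ; suc)
open import Data.Nat.Properties using (+-0-commutativeMonoid)
open import Data.Product.Base using (Σ; ∃; _×_; _,_)
open import Data.Product using (∃!)
open import Data.Sum.Base using (_⊎_)
open import Data.Vec.Functional using (Vector)
open import Function.Bundles using (Injection)
open import Level using (Level; 0ℓ)
open import Relation.Binary.Bundles using (Setoid)
open import Relation.Binary.Core using (Rel)
import Relation.Binary.Construct.StrictToNonStrict as StrictToNonStrict
open import Relation.Binary.PropositionalEquality.Core using (_≡_; _≢_)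
import Relation.Binary.PropositionalEquality.Properties as ≡
open import Relation.Binary.Structures using (IsStrictTotalOrder)
open import Relation.Nullary.Negation.Core using (¬_)
open import Relation.Unary using (Pred; _∈_; _⊆_; _≐_; ∁; ⋃; U; Satisfiable)

-- The inverse is total; its value at 0# is unspecified.

record OrderedField : Set₁ where
  field
    commutativeRing : CommutativeRing 0ℓ 0ℓ

  open CommutativeRing commutativeRing public

  infix  4 _<_
  infix  8 _⁻¹

  field
    0≉1                : ¬ (0# ≈ 1#)
    _⁻¹                : Carrier → Carrier
    ⁻¹-cong            : ∀ {x y} → x ≈ y → x ⁻¹ ≈ y ⁻¹
    ⁻¹-inverse         : ∀ x → ¬ (x ≈ 0#) → x * x ⁻¹ ≈ 1#
    _<_                : Rel Carrier 0ℓ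
    isStrictTotalOrder : IsStrictTotalOrder _≈_ _<_
    +-monoˡ-<          : ∀ z {x y} → x < y → x + z < y + z
    *-pos              : ∀ {x y} → 0# < x → 0# < y → 0# < x * y

  open IsStrictTotalOrder isStrictTotalOrder public using (_≟_; compare)
  open StrictToNonStrict _≈_ _<_ public using (_≤_)

  IsUpperBound IsLowerBound IsSup IsInf :
    ∀ {ℓ} → Pred Carrier ℓ → Carrier → Set ℓ
  IsUpperBound P u = ∀ {x} → x ∈ P → x ≤ u
  IsLowerBound P l = ∀ {x} → x ∈ P → l ≤ x
  IsSup P s = IsUpperBound P s × (∀ u → IsUpperBound P u → s ≤ u)
  IsInf P s = IsLowerBound P s × (∀ l → IsLowerBound P l → l ≤ s)

-- The classical real numbers, which are the complete ordered field up to
-- isomorphism.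

record CompleteOrderedField : Set₁ where
  field
    orderedField : OrderedField

  open OrderedField orderedField public

  field
    complete : (P : Pred Carrier 0ℓ) → Satisfiable P → ∃ (IsUpperBound P) →
               ∃ (IsSup P)

module Spherical (ℝ : CompleteOrderedField) where

  open CompleteOrderedField ℝ public
  open RawMonoidDefs +-rawMonoid public using (sum)
  open RawMonoidDefs *-rawMonoid public using () renaming (sum to product)
  open Exp semiring public using (_^_)

  fromℕ : ℕ → Carrier
  fromℕ n = RawMonoidDefs._×_ +-rawMonoid n 1#

  1/_ : ℕ → Carrier
  1/ n = fromℕ n ⁻¹

  infixl 6 _⊖_
  _⊖_ : ∀ {m} → Vector Carrier m → Vector Carrier m → Vector Carrier m
  (x ⊖ y) i = x i - y i

  ⟨_,_⟩ : ∀ {m} → Vector Carrier m → Vector Carrier m → Carrier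
  ⟨ x , y ⟩ = sum (λ i → x i * y i)

  dist² : ∀ {m} → Vector Carrier m → Vector Carrier m → Carrier
  dist² x y = ⟨ x ⊖ y , x ⊖ y ⟩

  -- Sphere d is the unit sphere of dimension d, inside ℝ^(d+1).

  record Sphere (d : ℕ) : Set where
    constructor _,_
    field
      point : Vector Carrier (suc d)
      unit  : ⟨ point , point ⟩ ≈ 1#

  open Sphere public

  sphereSetoid : ℕ → Setoid 0ℓ 0ℓ
  sphereSetoid d = record
    { Carrier       = Sphere d
    ; _≈_           = λ x y → ∀ i → point x i ≈ point y i
    ; isEquivalence = record
      { refl  = λ _ → refl
      ; sym   = λ p i → sym (p i)
      ; trans = λ p q i → trans (p i) (q i)
      }
    }

  module _ {d : ℕ} where

    Open : Pred (Pred (Sphere d) 0ℓ) 0ℓ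
    Open A = ∀ x → x ∈ A → ∃ λ ε → 0# < ε ×
             (∀ y → dist² (point x) (point y) < ε ^ 2 → y ∈ A)

    data Borel : Pred (Sphere d) 0ℓ → Set₁ where
      open-set   : ∀ {A} → Open A → Borel A
      complement : ∀ {A} → Borel A → Borel (∁ A)
      union      : ∀ {A : ℕ → Pred (Sphere d) 0ℓ} → (∀ k → Borel (A k)) →
                   Borel (⋃ ℕ A)
      resp       : ∀ {A B} → A ≐ B → Borel A → Borel B

    -- For nonnegative terms the sum of a series is the supremum of its
    -- partial sums.

    IsSeriesSum : (ℕ → Carrier) → Carrier → Set
    IsSeriesSum a = IsSup (λ s → ∃ λ m → s ≈ sum {m} (λ i → a (toℕ i)))

    -- A countable cover of A by sets U k of diameter at most r k ≤ δ,
    -- of total cost c = Σ (r k)^d.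

    record Cover (A : Pred (Sphere d) 0ℓ) (δ c : Carrier) : Set₁ where
      field
        part     : ℕ → Pred (Sphere d) 0ℓ
        r        : ℕ → Carrier
        covers   : A ⊆ ⋃ ℕ part
        0≤r      : ∀ k → 0# ≤ r k
        r≤δ      : ∀ k → r k ≤ δ
        diameter : ∀ k {x y} → x ∈ part k → y ∈ part k →
                   dist² (point x) (point y) ≤ r k ^ 2
        cost     : IsSeriesSum (λ k → r k ^ d) c

    -- IsHausdorffMeasure A h: the d-dimensional Hausdorff measure of A,
    -- sup_{δ>0} inf {cost of covers of A of mesh ≤ δ}, is h.  This is
    -- surface measure up to a constant factor when d ≥ 1 (for d = 0, the
    -- empty members of a cover would have to be given cost 0).

    IsHausdorffMeasure : Pred (Sphere d) 0ℓ → Carrier → Set₁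
    IsHausdorffMeasure A =
      IsSup (λ h → ∃ λ δ → 0# < δ × IsInf (Cover A δ) h)

    -- Normalized surface measure σ.

    IsMeasure : Pred (Sphere d) 0ℓ → Carrier → Set₁
    IsMeasure A v = ∃ λ a → ∃ λ s →
      IsHausdorffMeasure A a × IsHausdorffMeasure U s × v ≈ a * s ⁻¹

    record SimpleFunction : Set₁ where
      field
        {size}    : ℕ
        piece     : Fin size → Pred (Sphere d) 0ℓ
        partition : ∀ x → ∃! _≡_ (λ i → x ∈ piece i)
        borel     : ∀ i → Borel (piece i)
        value     : Fin size → Carrier
        σ         : Fin size → Carrier
        σ-measure : ∀ i → IsMeasure (piece i) (σ i)

      integral : Carrier
      integral = sum (λ i → value i * σ i)

    open SimpleFunction

    LowerSum UpperSum : (Sphere d → Carrier) → Pred Carrier _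
    LowerSum f s = Σ SimpleFunction λ φ →
      (∀ i x → x ∈ piece φ i → value φ i ≤ f x) × s ≈ integral φ
    UpperSum f s = Σ SimpleFunction λ φ →
      (∀ i x → x ∈ piece φ i → f x ≤ value φ i) × s ≈ integral φ

    -- The Lebesgue integral of a bounded function f with respect to σ
    -- exists and equals v.

    IsIntegral : (Sphere d → Carrier) → Carrier → Set₁
    IsIntegral f v = IsSup (LowerSum f) v × IsInf (UpperSum f) v

  -- Polynomials in m variables of total degree at most τ, as finite sums
  -- of monomials.

  record Monomial (m τ : ℕ) : Set where
    field
      coefficient : Carrier
      exponent    : Vector ℕ m
      degree≤τ    :
        RawMonoidDefs.sum (CommutativeMonoid.rawMonoid +-0-commutativeMonoid)
          exponent ℕ.≤ τ

    evalMonomial : Vector Carrier m → Carrier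
    evalMonomial x = coefficient * product (λ i → x i ^ exponent i)

  open Monomial public using (evalMonomial)

  Polynomial : ℕ → ℕ → Set
  Polynomial m τ = List (Monomial m τ)

  eval : ∀ {m τ} → Polynomial m τ → Vector Carrier m → Carrier
  eval p x = foldr (λ q s → evalMonomial q x + s) 0# p

  -- A finite subset of the sphere with exactly N points, given by an
  -- injective enumeration.

  Code : ℕ → ℕ → Set
  Code d N = Injection (≡.setoid (Fin N)) (sphereSetoid d)

  module _ {d N : ℕ} (C : Code d N) where

    private
      pt : Fin N → Vector Carrier (suc d)
      pt i = point (Injection.to C i)

    IsDesign : ℕ → Set₁
    IsDesign τ = (p : Polynomial (suc d) τ) →
      IsIntegral {d} (λ x → eval p (point x))
                     (1/ N * sum (λ i → eval p (pt i)))

    InnerProducts : Pred Carrier 0ℓ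
    InnerProducts t = ∃ λ i → ∃ λ j → i ≢ j × t ≈ ⟨ pt i , pt j ⟩

    -- A t i is A_t(x) for x the i-th point of C.

    A : Carrier → Fin N → ℕ
    A t i = length (filter (λ j → ⟨ pt i , pt j ⟩ ≟ t) (allFin N))

    DistanceInvariant : Set
    DistanceInvariant = ∀ t → - 1# ≤ t → t < 1# → ∀ i j → A t i ≡ A t j

  F : Pred Carrier 0ℓ
  F t = (- (1/ 3) < t × t < - (1/ 6)) ⊎ (1/ 6 < t × t < 1/ 3)

{-# OPTIONS --safe #-}
module Submission where

-- The integral is invariant under every reflection, because Hausdorff measure
-- only depends on distances.  Hence in a design of strength 11 the power sum
-- Σ ⟨ a , x ⟩ ^ k over x ∈ C, for k ≤ 11, depends only on the norm of a.
-- Together with ⟨ x , x ⟩ = 1 this invariance determines all the moments, so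
-- no integral has to be computed.
--
-- With u = 6 ⟨ x , y ⟩, the polynomial
--   (u² - 9)² u² (u² - 4) (u² - 1) (u + 6)
-- of degree 11 is nonnegative for admissible ⟨ x , y ⟩.  Summing it over y ∈ C
-- bounds |C| from below by its value at u = 6 over its mean.  In case of
-- equality all u ≠ 6 are roots, and summing the Lagrange polynomials of the
-- nine nodes over y ∈ C gives the distance distribution.

open import Defs
open import Algebra.Bundles using (RawRing)
import Algebra.Definitions.RawMonoid as RawMonoidDefs
import Algebra.Properties.AbelianGroup as AbelianGroupProperties
import Algebra.Properties.CommutativeMonoid.Sum as CommutativeMonoidSum
import Algebra.Properties.CommutativeSemigroup as CommutativeSemigroupProperties
import Algebra.Properties.CommutativeSemiring.Exp as CommutativeSemiringExp
import Algebra.Properties.Group as GroupProperties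
import Algebra.Properties.Monoid.Mult as MonoidMult
import Algebra.Properties.Ring as RingProperties
import Algebra.Properties.Semiring.Exp as SemiringExp
import Algebra.Properties.Semiring.Mult as SemiringMult
import Algebra.Properties.Semiring.Sum as SemiringSum
import Algebra.Solver.Ring as RingSolver
open import Algebra.Solver.Ring.AlmostCommutativeRing using
  (AlmostCommutativeRing; fromCommutativeRing; _-Raw-AlmostCommutative⟶_; Induced-equivalence)
open import Data.Fin.Base using (Fin; zero; suc; fromℕ<)
import Data.Fin.Properties as Fin
open import Data.Integer.Base as ℤ using (ℤ; +_; -[1+_])
import Data.Integer.Properties as ℤ
open import Data.List.Base using (List; []; _∷_; _++_; map; concat; tabulate; length; filter; allFin)
open import Data.List.Membership.DecPropositional ℤ._≟_ using (_∈?_)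
open import Data.List.Membership.Propositional as ∈ using () renaming (_∈_ to _∈ₗ_)
open import Data.List.Membership.Propositional.Properties using (∈-filter⁺)
open import Data.List.Properties using (filter-none)
open import Data.List.Relation.Unary.All as All using (All; []; _∷_; all?)
open import Data.List.Relation.Unary.Any as Any using (Any; here; there; any?)
import Data.List.Relation.Unary.Any.Properties as Any
open import Data.Maybe.Base as Maybe using ()
open import Data.Nat.Base as ℕ using (ℕ; zero; suc; NonZero; s≤s; z≤n)
import Data.Nat.Properties as ℕ
open import Data.Product.Base using (_×_; _,_; proj₁)
open import Data.Sum.Base using (_⊎_; inj₁; inj₂)
open import Data.Vec.Functional using (Vector; updateAt)
open import Function.Base using (_∘_; const)
open import Function.Bundles using (Injection)
open import Level using (Level; 0ℓ)
open import Relation.Binary.Bundles using (StrictTotalOrder; DecTotalOrder)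
open import Relation.Binary.Definitions using (WeaklyDecidable; tri<; tri≈; tri>)
import Relation.Binary.Properties.StrictTotalOrder as StrictTotalOrderProperties
open import Relation.Binary.PropositionalEquality.Core as ≡ using (_≡_; _≢_)
import Relation.Binary.Reasoning.Setoid as ≈-Reasoning
open import Relation.Binary.Structures using (IsStrictTotalOrder)
open import Relation.Nullary.Decidable.Core using (yes; no; ¬?; dec⇒maybe; from-yes)
open import Relation.Nullary.Negation.Core using (¬_; contradiction)
open import Relation.Unary using (Pred; Decidable; _∈_; _∉_; _⊆_)

-- Two vectors of equal norm are exchanged by the reflection orthogonal to their difference, so one
-- reflection suffices to compare their power sums. `IsIntegral` is a relation defined through
-- covers, Borel sets and simple functions; each of these is pulled back along the reflection, and
-- uniqueness of suprema then compares the two averages. Points of the sphere are equal only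
-- coordinatewise, and a predicate may ignore this equality, hence the passage through
-- `Extensional`. For the moments, x ^ k is multiplied by the sum of all squared coordinates, which
-- is 1. Each mixed term x ^ k * y ^ 2 is a combination of powers of linear forms p x + q y. With (p
-- , q) from a Pythagorean triple the form has an integer norm r, so its power sum is r ^ (2 + k)
-- times that of x, without square roots. This yields a two-term recurrence. The numerical facts
-- live in ℤ, where they hold by computation: products are scaled by 6, moments by a common
-- denominator, and `fromℤ` transfers the results.

module OrderedFieldProperties (K : OrderedField) where

  open OrderedField K hiding (zero)
  open GroupProperties +-group using (⁻¹-involutive; ε⁻¹≈ε; x∙y⁻¹≈ε⇒x≈y; x≈y⇒x∙y⁻¹≈ε)
  open AbelianGroupProperties +-abelianGroup using (⁻¹-∙-comm)
  open RingProperties ring using (-‿distribˡ-*; -‿distribʳ-*)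
  open SemiringMult semiring using (×1-homo-*) renaming (_×_ to _·_)
  open MonoidMult +-monoid using (×-homo-+)
  open ≈-Reasoning setoid

  open IsStrictTotalOrder isStrictTotalOrder public using (irrefl; asym)
    renaming (trans to <-trans; <-respˡ-≈ to <-respˡ; <-respʳ-≈ to <-respʳ)
  open RawMonoidDefs +-rawMonoid using (sum)

  strictTotalOrder : StrictTotalOrder _ _ _
  strictTotalOrder = record { isStrictTotalOrder = isStrictTotalOrder }

  open DecTotalOrder (StrictTotalOrderProperties.decTotalOrder strictTotalOrder) public
    using (≤-respʳ-≈; ≤-respˡ-≈)
    renaming (refl to ≤-refl; trans to ≤-trans; antisym to ≤-antisym)

  -- The integers in an ordered field

  private
    ι : ℕ → Carrier
    ι n = n · 1#

  -- Abstract, because unfolding fromℤ at a large literal produces a unary numeral.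

  abstract

    fromℤ : ℤ → Carrier
    fromℤ (+ n)    = ι n
    fromℤ -[1+ n ] = - ι (suc n)

    fromℤ-pos : ∀ n → fromℤ (+ n) ≈ ι n
    fromℤ-pos n = refl

    fromℤ-⊖ : ∀ m n → fromℤ (m ℤ.⊖ n) ≈ ι m - ι n
    fromℤ-⊖ m zero = begin
      ι m        ≈⟨ +-identityʳ (ι m) ⟨
      ι m + 0#   ≈⟨ +-congˡ ε⁻¹≈ε ⟨
      ι m - 0#   ∎
    fromℤ-⊖ zero (suc n) = sym (+-identityˡ _)
    fromℤ-⊖ (suc m) (suc n) = begin
      fromℤ (suc m ℤ.⊖ suc n)            ≡⟨ ≡.cong fromℤ (ℤ.[1+m]⊖[1+n]≡m⊖n m n) ⟩
      fromℤ (m ℤ.⊖ n)                    ≈⟨ fromℤ-⊖ m n ⟩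
      ι m - ι n                          ≈⟨ +-identityˡ _ ⟨
      0# + (ι m - ι n)                   ≈⟨ +-congʳ (-‿inverseʳ 1#) ⟨
      (1# - 1#) + (ι m - ι n)            ≈⟨ interchange 1# (- 1#) (ι m) (- ι n) ⟩
      (1# + ι m) + (- 1# - ι n)          ≈⟨ +-congˡ (⁻¹-∙-comm 1# (ι n)) ⟩
      (1# + ι m) - (1# + ι n)            ∎
      where open CommutativeSemigroupProperties +-commutativeSemigroup using (interchange)

    fromℤ-+ : ∀ i j → fromℤ (i ℤ.+ j) ≈ fromℤ i + fromℤ j
    fromℤ-+ (+ m)    (+ n)    = ×-homo-+ 1# m n
    fromℤ-+ (+ m)    -[1+ n ] = fromℤ-⊖ m (suc n)
    fromℤ-+ -[1+ m ] (+ n)    = trans (fromℤ-⊖ n (suc m)) (+-comm _ _)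
    fromℤ-+ -[1+ m ] -[1+ n ] = begin
      - ι (suc (suc (m ℕ.+ n)))     ≡⟨ ≡.cong (λ k → - ι (suc k)) (ℕ.+-suc m n) ⟨
      - ι (suc m ℕ.+ suc n)         ≈⟨ -‿cong (×-homo-+ 1# (suc m) (suc n)) ⟩
      - (ι (suc m) + ι (suc n))     ≈⟨ ⁻¹-∙-comm _ _ ⟨
      - ι (suc m) - ι (suc n)       ∎

    fromℤ-neg : ∀ i → fromℤ (ℤ.- i) ≈ - fromℤ i
    fromℤ-neg (+ zero)  = sym ε⁻¹≈ε
    fromℤ-neg (+ suc n) = refl
    fromℤ-neg -[1+ n ]  = sym (⁻¹-involutive _)

    fromℤ-pos-* : ∀ m j → fromℤ (+ m ℤ.* j) ≈ fromℤ (+ m) * fromℤ j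
    fromℤ-pos-* m (+ n) = begin
      fromℤ (+ m ℤ.* + n)   ≡⟨ ≡.cong fromℤ (ℤ.pos-* m n) ⟨
      ι (m ℕ.* n)           ≈⟨ ×1-homo-* m n ⟩
      ι m * ι n             ∎
    fromℤ-pos-* m -[1+ n ] = begin
      fromℤ (+ m ℤ.* -[1+ n ])     ≡⟨ ≡.cong fromℤ (ℤ.neg-distribʳ-* (+ m) (+ suc n)) ⟨
      fromℤ (ℤ.- (+ m ℤ.* + suc n)) ≈⟨ fromℤ-neg (+ m ℤ.* + suc n) ⟩
      - fromℤ (+ m ℤ.* + suc n)    ≈⟨ -‿cong (fromℤ-pos-* m (+ suc n)) ⟩
      - (ι m * ι (suc n))          ≈⟨ -‿distribʳ-* _ _ ⟩
      ι m * - ι (suc n)            ∎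

    fromℤ-* : ∀ i j → fromℤ (i ℤ.* j) ≈ fromℤ i * fromℤ j
    fromℤ-* (+ m) j = fromℤ-pos-* m j
    fromℤ-* -[1+ m ] j = begin
      fromℤ (-[1+ m ] ℤ.* j)       ≡⟨ ≡.cong fromℤ (ℤ.neg-distribˡ-* (+ suc m) j) ⟨
      fromℤ (ℤ.- (+ suc m ℤ.* j))  ≈⟨ fromℤ-neg (+ suc m ℤ.* j) ⟩
      - fromℤ (+ suc m ℤ.* j)      ≈⟨ -‿cong (fromℤ-pos-* (suc m) j) ⟩
      - (ι (suc m) * fromℤ j)      ≈⟨ -‿distribˡ-* _ _ ⟩
      - ι (suc m) * fromℤ j        ∎

    fromℤ-0 : fromℤ (+ 0) ≈ 0#
    fromℤ-0 = refl

    fromℤ-1 : fromℤ (+ 1) ≈ 1#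
    fromℤ-1 = +-identityʳ 1#

  fromℤ-cong-≡ : ∀ {i j} → i ≡ j → fromℤ i ≈ fromℤ j
  fromℤ-cong-≡ i≡j = reflexive (≡.cong fromℤ i≡j)

  ℤ-rawRing : RawRing 0ℓ 0ℓ
  ℤ-rawRing = record { _≈_ = _≡_ ; _+_ = ℤ._+_ ; _*_ = ℤ._*_ ; -_ = ℤ.-_ ; 0# = + 0 ; 1# = + 1 }

  almostCommutativeRing : AlmostCommutativeRing 0ℓ 0ℓ
  almostCommutativeRing = fromCommutativeRing commutativeRing

  fromℤ-morphism : ℤ-rawRing -Raw-AlmostCommutative⟶ almostCommutativeRing
  fromℤ-morphism = record
    { ⟦_⟧    = fromℤ
    ; +-homo = fromℤ-+
    ; *-homo = fromℤ-*
    ; -‿homo = fromℤ-neg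
    ; 0-homo = fromℤ-0
    ; 1-homo = fromℤ-1
    }

  fromℤ-≟ : WeaklyDecidable (Induced-equivalence fromℤ-morphism)
  fromℤ-≟ i j = Maybe.map fromℤ-cong-≡ (dec⇒maybe (i ℤ.≟ j))

  -- With integer coefficients the solver compares numerals by computing in ℤ, which the abstract
  -- carrier cannot do.
  module Solver = RingSolver ℤ-rawRing almostCommutativeRing fromℤ-morphism fromℤ-≟

  open Solver using (solve; con; _:+_; _:*_; _:-_; :-_; _:=_)

  -- Order and finite sums

  ≤⇒≯ : ∀ {x y} → x ≤ y → ¬ (y < x)
  ≤⇒≯ (inj₁ x<y) y<x = asym x<y y<x
  ≤⇒≯ (inj₂ x≈y) y<x = irrefl (sym x≈y) y<x

  ≮⇒≥ : ∀ {x y} → ¬ (x < y) → y ≤ x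
  ≮⇒≥ {x} {y} x≮y with compare x y
  ... | tri< x<y _ _ = contradiction x<y x≮y
  ... | tri≈ _ x≈y _ = inj₂ (sym x≈y)
  ... | tri> _ _ y<x = inj₁ y<x

  x<y⇒0<y-x : ∀ {x y} → x < y → 0# < y - x
  x<y⇒0<y-x {x} x<y = <-respˡ (-‿inverseʳ x) (+-monoˡ-< (- x) x<y)

  0<y-x⇒x<y : ∀ {x y} → 0# < y - x → x < y
  0<y-x⇒x<y {x} {y} 0<y-x =
    <-respˡ (+-identityˡ x) (<-respʳ (solve 2 (λ y x → y :- x :+ x := y) refl y x)
      (+-monoˡ-< x 0<y-x))

  x≤y⇒0≤y-x : ∀ {x y} → x ≤ y → 0# ≤ y - x
  x≤y⇒0≤y-x     (inj₁ x<y) = inj₁ (x<y⇒0<y-x x<y)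
  x≤y⇒0≤y-x {x} (inj₂ x≈y) = inj₂ (trans (sym (-‿inverseʳ x)) (+-congʳ x≈y))

  +-monoˡ-≤ : ∀ z {x y} → x ≤ y → x + z ≤ y + z
  +-monoˡ-≤ z (inj₁ x<y) = inj₁ (+-monoˡ-< z x<y)
  +-monoˡ-≤ z (inj₂ x≈y) = inj₂ (+-congʳ x≈y)

  +-monoʳ-≤ : ∀ z {x y} → x ≤ y → z + x ≤ z + y
  +-monoʳ-≤ z x≤y = ≤-respˡ-≈ (+-comm _ z) (≤-respʳ-≈ (+-comm _ z) (+-monoˡ-≤ z x≤y))

  +-nonneg : ∀ {x y} → 0# ≤ x → 0# ≤ y → 0# ≤ x + y
  +-nonneg {x} {y} 0≤x 0≤y =
    ≤-trans 0≤y (≤-respˡ-≈ (+-identityˡ y) (+-monoˡ-≤ y 0≤x))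

  *-nonneg : ∀ {x y} → 0# ≤ x → 0# ≤ y → 0# ≤ x * y
  *-nonneg     (inj₁ 0<x) (inj₁ 0<y) = inj₁ (*-pos 0<x 0<y)
  *-nonneg {x} (inj₁ _)   (inj₂ 0≈y) = inj₂ (trans (sym (zeroʳ x)) (*-congˡ 0≈y))
  *-nonneg {y = y} (inj₂ 0≈x) _      = inj₂ (trans (sym (zeroˡ y)) (*-congʳ 0≈x))

  -- Both factors are nonpositive, and changing both signs keeps the product.
  *-nonneg-flip : ∀ {x y z w} → x ≤ y → z ≤ w → 0# ≤ (x - y) * (z - w)
  *-nonneg-flip {x} {y} {z} {w} x≤y z≤w =
    ≤-respʳ-≈ (solve 4 (λ x y z w → (y :- x) :* (w :- z) := (x :- y) :* (z :- w)) refl x y z w)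
      (*-nonneg (x≤y⇒0≤y-x x≤y) (x≤y⇒0≤y-x z≤w))

  *-monoˡ-≤ : ∀ {c x y} → 0# ≤ c → x ≤ y → c * x ≤ c * y
  *-monoˡ-≤ {c} {x} {y} 0≤c x≤y =
    ≤-respˡ-≈ (+-identityˡ _) (≤-respʳ-≈
      (solve 3 (λ c x y → c :* (y :- x) :+ c :* x := c :* y) refl c x y)
      (+-monoˡ-≤ (c * x) (*-nonneg 0≤c (x≤y⇒0≤y-x x≤y))))

  *-cancelˡ-< : ∀ {c x y} → 0# ≤ c → c * x < c * y → x < y
  *-cancelˡ-< {c} {x} {y} 0≤c cx<cy with compare x y
  ... | tri< x<y _ _ = x<y
  ... | tri≈ _ x≈y _ = contradiction cx<cy (irrefl (*-congˡ x≈y))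
  ... | tri> _ _ y<x = contradiction cx<cy (≤⇒≯ (*-monoˡ-≤ 0≤c (inj₁ y<x)))

  square-nonneg : ∀ x → 0# ≤ x * x
  square-nonneg x with compare 0# x
  ... | tri< 0<x _ _ = *-nonneg (inj₁ 0<x) (inj₁ 0<x)
  ... | tri≈ _ 0≈x _ = *-nonneg (inj₂ 0≈x) (inj₂ 0≈x)
  ... | tri> _ _ x<0 = ≤-respʳ-≈ (*-cong x-0≈x x-0≈x) (*-nonneg-flip (inj₁ x<0) (inj₁ x<0))
    where
    x-0≈x : x - 0# ≈ x
    x-0≈x = trans (+-congˡ ε⁻¹≈ε) (+-identityʳ x)

  x*y≈0⇒x≈0∨y≈0 : ∀ x y → x * y ≈ 0# → x ≈ 0# ⊎ y ≈ 0#
  x*y≈0⇒x≈0∨y≈0 x y xy≈0 with x ≟ 0#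
  ... | yes x≈0 = inj₁ x≈0
  ... | no  x≉0 = inj₂ (begin
    y                ≈⟨ *-identityˡ y ⟨
    1# * y           ≈⟨ *-congʳ (⁻¹-inverse x x≉0) ⟨
    x * x ⁻¹ * y     ≈⟨ solve 3 (λ x w y → x :* w :* y := w :* (x :* y)) refl x (x ⁻¹) y ⟩
    x ⁻¹ * (x * y)   ≈⟨ *-congˡ xy≈0 ⟩
    x ⁻¹ * 0#        ≈⟨ zeroʳ _ ⟩
    0#               ∎)

  x-y≈0⇒x≈y : ∀ {x y} → x - y ≈ 0# → x ≈ y
  x-y≈0⇒x≈y = x∙y⁻¹≈ε⇒x≈y _ _

  *-cancelˡ : ∀ {c x y} → ¬ (c ≈ 0#) → c * x ≈ c * y → x ≈ y
  *-cancelˡ {c} {x} {y} c≉0 cx≈cy with x*y≈0⇒x≈0∨y≈0 c (x - y)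
    (trans (solve 3 (λ c x y → c :* (x :- y) := c :* x :- c :* y) refl c x y)
      (x≈y⇒x∙y⁻¹≈ε cx≈cy))
  ... | inj₁ c≈0   = contradiction c≈0 c≉0
  ... | inj₂ x-y≈0 = x-y≈0⇒x≈y x-y≈0

  -- 1 is a square, hence nonnegative, and it differs from 0.
  0<1 : 0# < 1#
  0<1 with ≤-respʳ-≈ (*-identityˡ 1#) (square-nonneg 1#)
  ... | inj₁ 0<1′ = 0<1′
  ... | inj₂ 0≈1  = contradiction 0≈1 0≉1

  0<ι : ∀ n → 0# < ι (suc n)
  0<ι zero    = <-respʳ (sym (+-identityʳ 1#)) 0<1
  0<ι (suc n) = <-trans (0<ι n) (<-respˡ (+-identityˡ _) (+-monoˡ-< (ι (suc n)) 0<1))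

  fromℤ-positive : ∀ {i} → + 0 ℤ.< i → 0# < fromℤ i
  fromℤ-positive {+ suc n} _ = <-respʳ (sym (fromℤ-pos (suc n))) (0<ι n)
  fromℤ-positive {+ zero} (ℤ.+<+ ())

  fromℤ-mono-< : ∀ {i j} → i ℤ.< j → fromℤ i < fromℤ j
  fromℤ-mono-< {i} {j} i<j = 0<y-x⇒x<y (<-respʳ
    (trans (fromℤ-+ j (ℤ.- i)) (+-congˡ (fromℤ-neg i))) (fromℤ-positive
    (≡.subst (ℤ._< j ℤ.- i) (ℤ.+-inverseʳ i) (ℤ.+-monoˡ-< (ℤ.- i) i<j))))

  fromℤ-cancel-≤ : ∀ {i j} → fromℤ i ≤ fromℤ j → i ℤ.≤ j
  fromℤ-cancel-≤ i≤j = ℤ.≮⇒≥ λ j<i → ≤⇒≯ i≤j (fromℤ-mono-< j<i)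

  -- Brings equations proved in the field back to ℤ, where the counts can be read off.
  fromℤ-injective : ∀ {i j} → fromℤ i ≈ fromℤ j → i ≡ j
  fromℤ-injective i≈j =
    ℤ.≤-antisym (fromℤ-cancel-≤ (inj₂ i≈j)) (fromℤ-cancel-≤ (inj₂ (sym i≈j)))

  fromℤ-nonzero : ∀ {i} → i ≢ + 0 → ¬ (fromℤ i ≈ 0#)
  fromℤ-nonzero i≢0 i≈0 = i≢0 (fromℤ-injective (trans i≈0 (sym fromℤ-0)))

  -- Off the open interval the two factors have the same sign, or one of them vanishes.
  outside-interval : ∀ {a b x} → a < b → ¬ (a < x × x < b) → 0# ≤ (x - a) * (x - b)
  outside-interval {a} {b} {x} a<b x∉ with compare a x
  ... | tri< a<x _ _ = *-nonneg (x≤y⇒0≤y-x (inj₁ a<x)) (x≤y⇒0≤y-x (≮⇒≥ λ x<b → x∉ (a<x , x<b)))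
  ... | tri≈ _ a≈x _ = *-nonneg-flip (inj₂ (sym a≈x)) (inj₁ (<-respˡ a≈x a<b))
  ... | tri> _ _ x<a = *-nonneg-flip (inj₁ x<a) (inj₁ (<-trans x<a a<b))

  sum-nonneg : ∀ {n} (h : Vector Carrier n) → (∀ i → 0# ≤ h i) → 0# ≤ sum h
  sum-nonneg {zero}  h 0≤h = ≤-refl
  sum-nonneg {suc n} h 0≤h = +-nonneg (0≤h zero) (sum-nonneg (λ i → h (suc i)) (λ i → 0≤h (suc i)))

  term≤sum : ∀ {n} (h : Vector Carrier n) → (∀ i → 0# ≤ h i) → ∀ i → h i ≤ sum h
  term≤sum h 0≤h zero = ≤-respˡ-≈ (+-identityʳ (h zero))
    (+-monoʳ-≤ (h zero) (sum-nonneg _ λ i → 0≤h (suc i)))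
  term≤sum h 0≤h (suc i) = ≤-trans (term≤sum _ (λ j → 0≤h (suc j)) i)
    (≤-respˡ-≈ (+-identityˡ _) (+-monoˡ-≤ _ (0≤h zero)))

  two-terms≤sum : ∀ {n} (h : Vector Carrier n) → (∀ i → 0# ≤ h i) →
                  ∀ {i j} → i ≢ j → h i + h j ≤ sum h
  two-terms≤sum h 0≤h {zero}  {zero}  i≢j = contradiction ≡.refl i≢j
  two-terms≤sum h 0≤h {zero}  {suc j} _   =
    +-monoʳ-≤ (h zero) (term≤sum _ (λ k → 0≤h (suc k)) j)
  two-terms≤sum h 0≤h {suc i} {zero}  _   = ≤-respˡ-≈ (+-comm _ _)
    (+-monoʳ-≤ (h zero) (term≤sum _ (λ k → 0≤h (suc k)) i))
  two-terms≤sum h 0≤h {suc i} {suc j} i≢j =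
    ≤-trans (two-terms≤sum _ (λ k → 0≤h (suc k)) λ i≡j → i≢j (≡.cong suc i≡j))
      (≤-respˡ-≈ (+-identityˡ _) (+-monoˡ-≤ _ (0≤h zero)))

  sum≈0⇒terms≈0 : ∀ {n} (h : Vector Carrier n) → (∀ i → 0# ≤ h i) → sum h ≈ 0# → ∀ i → h i ≈ 0#
  sum≈0⇒terms≈0 h 0≤h Σ≈0 i = ≤-antisym (≤-respʳ-≈ Σ≈0 (term≤sum h 0≤h i)) (0≤h i)

  -- From h i + h j ≤ sum h ≈ h i there is no room left for a positive h j. This is the engine of
  -- the equality case.
  sum≈term⇒others≈0 : ∀ {n} (h : Vector Carrier n) → (∀ i → 0# ≤ h i) →
                      ∀ {i} → sum h ≈ h i → ∀ {j} → i ≢ j → h j ≈ 0#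
  sum≈term⇒others≈0 h 0≤h {i} Σ≈hi {j} i≢j = ≤-antisym
    (≤-respˡ-≈ (solve 2 (λ x y → :- x :+ (x :+ y) := y) refl (h i) (h j))
      (≤-respʳ-≈ (-‿inverseˡ (h i))
        (+-monoʳ-≤ (- h i) (≤-respʳ-≈ Σ≈hi (two-terms≤sum h 0≤h i≢j)))))
    (0≤h j)

  ι≈0⇒≡0 : ∀ n → ι n ≈ 0# → n ≡ 0
  ι≈0⇒≡0 zero    _    = ≡.refl
  ι≈0⇒≡0 (suc n) ι≈0 = contradiction (0<ι n) (irrefl (sym ι≈0))

-- The numerical certificate

-- weight ∙[ p , q , r ] stands for weight * ((p x + q y) ^ k + (p x - q y) ^ k),
-- where (p , q) has length r.

infix 6 _∙[_,_,_]

record PowerPair : Set where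
  constructor _∙[_,_,_]
  field
    weight : ℤ
    p q r  : ℕ

  Pythagorean : Set
  Pythagorean = p ℕ.* p ℕ.+ q ℕ.* q ≡ r ℕ.* r

open PowerPair using (Pythagorean)

-- The factor of the k-th moment that remains once each (p x ± q y) ^ k is replaced by (r x) ^ k;
-- the 2 counts the two signs.
totalWeight : ℕ → List PowerPair → ℤ
totalWeight k []       = + 0
totalWeight k (t ∷ ts) = weight ℤ.* (+ 2 ℤ.* (+ r) ℤ.^ k) ℤ.+ totalWeight k ts
  where open PowerPair t

rootProductℤ : List ℤ → ℤ → ℤ
rootProductℤ []       s = + 1
rootProductℤ (r ∷ rs) s = (s ℤ.- r) ℤ.* rootProductℤ rs s

-- The value at u ^ k * Π (u - r) of the linear functional u ^ j ↦ c j.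

functional : (ℕ → ℤ) → ℕ → List ℤ → ℤ
functional c k []       = c k
functional c k (r ∷ rs) = functional c (suc k) rs ℤ.- r ℤ.* functional c k rs

commonDenominator : ℤ
commonDenominator = + 48 ℤ.* + 50 ℤ.* + 52 ℤ.* + 54 ℤ.* + 56

-- The moments 1·3⋯(k-1) / (48·50⋯(48+k-2)) of a coordinate on the sphere,
-- multiplied by the common denominator.

coordinateMoment : ℕ → ℤ
coordinateMoment 0  = commonDenominator
coordinateMoment 2  = + 7862400
coordinateMoment 4  = + 471744
coordinateMoment 6  = + 45360
coordinateMoment 8  = + 5880
coordinateMoment 10 = + 945
coordinateMoment _  = + 0

-- Inner products are multiplied by 6 to make the nodes integral.

scaledMoment : ℕ → ℤ
scaledMoment k = (+ 6) ℤ.^ k ℤ.* coordinateMoment k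

-- Pairs of a scaled inner product 6 t and the count claimed at t.
distribution : List (ℤ × ℕ)
distribution =
  (ℤ.- + 6 , 1) ∷
  (+ 3 , 36848) ∷ (ℤ.- + 3 , 36848) ∷
  (+ 2 , 1678887) ∷ (ℤ.- + 2 , 1678887) ∷
  (+ 1 , 12608784) ∷ (ℤ.- + 1 , 12608784) ∷
  (+ 0 , 23766960) ∷ []

-- 6 is the scaled product of a point with itself, which every sum over C contains; `distribution`
-- covers only t < 1.
nodes : List ℤ
nodes = + 6 ∷ map proj₁ distribution

-- The roots of the Lagrange polynomial of the node s; there are eight when s is a node.
otherNodes : ℤ → List ℤ
otherNodes s = filter (λ r → ¬? (r ℤ.≟ s)) nodes

-- The double roots ±3 and 0 make the extremal polynomial touch zero from above;
-- the simple roots ±1 and ±2 are the endpoints of F.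

extremalRoots : List ℤ
extremalRoots =
  + 3 ∷ + 3 ∷ ℤ.- + 3 ∷ ℤ.- + 3 ∷ + 0 ∷ + 0 ∷ ℤ.- + 2 ∷ ℤ.- + 1 ∷ + 1 ∷ + 2 ∷ ℤ.- + 6 ∷ []

bound : ℕ
bound = 52416000

extremalValue : ℤ
extremalValue = rootProductℤ extremalRoots (+ 6)

-- The value at 6 divided by the mean is 52416000. The common denominator on the left matches the
-- one hidden in `scaledMoment`.
extremal-ratio : commonDenominator ℤ.* extremalValue ≡ + bound ℤ.* functional scaledMoment 0 extremalRoots
extremal-ratio = ≡.refl

-- The last component is the sum of the unnormalised Lagrange polynomial of s over a code of b
-- points, to which only the v points at s contribute. The bound 11 lets the design evaluate this
-- sum, and the nonzero factor can be cancelled.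
CountEquation : ℤ → (ℕ → ℤ) → ℕ → ℤ × ℕ → Set
CountEquation D c b (s , v) =
  length (otherNodes s) ℕ.≤ 11 ×
  ℤ.NonZero (D ℤ.* rootProductℤ (otherNodes s) s) ×
  + v ℤ.* (D ℤ.* rootProductℤ (otherNodes s) s) ≡ functional c 0 (otherNodes s) ℤ.* + b

countEquations : All (CountEquation commonDenominator scaledMoment bound) distribution
countEquations =
  (8≤11 , _ , ≡.refl) ∷
  (8≤11 , _ , ≡.refl) ∷ (8≤11 , _ , ≡.refl) ∷
  (8≤11 , _ , ≡.refl) ∷ (8≤11 , _ , ≡.refl) ∷
  (8≤11 , _ , ≡.refl) ∷ (8≤11 , _ , ≡.refl) ∷
  (8≤11 , _ , ≡.refl) ∷ []
  where
  8≤11 : 8 ℕ.≤ 11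
  8≤11 = ℕ.m≤m+n 8 3

cancel-factor : ∀ {a v b n} (w f : ℤ) → ℤ.NonZero w → n ≡ b →
                + a ℤ.* w ≡ f ℤ.* + n → + v ℤ.* w ≡ f ℤ.* + b → a ≡ v
cancel-factor {a} {v} w f w≢0 ≡.refl aw≡fb vw≡fb =
  ℤ.+-injective (ℤ.*-cancelʳ-≡ (+ a) (+ v) w {{w≢0}} (≡.trans aw≡fb (≡.sym vw≡fb)))

extremalRoots⊆nodes : All (_∈ₗ nodes) extremalRoots
extremalRoots⊆nodes = from-yes (all? (_∈? nodes) extremalRoots)

module SphericalDesigns (ℝ : CompleteOrderedField) where

  open Spherical ℝ hiding (zero)
  open OrderedFieldProperties orderedField
  open Solver using (solve; con; _:+_; _:*_; _:-_; :-_; _:=_; _:^_)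
  open CommutativeMonoidSum +-commutativeMonoid
    using (sum-cong-≋; sum-replicate; sum-replicate-zero; ∑-distrib-+; ∑-comm)
  open CommutativeMonoidSum *-commutativeMonoid using ()
    renaming (sum-replicate-zero to product-replicate-one)
  open CommutativeMonoidSum ℕ.+-0-commutativeMonoid using ()
    renaming (sum to sumℕ; sum-replicate-zero to sumℕ-replicate-zero)
  open CommutativeSemiringExp commutativeSemiring using (^-distrib-*)
  open RingProperties ring using (-1*x≈-x)
  open SemiringExp semiring using (^-congˡ)
  open SemiringSum semiring using (*-distribˡ-sum; *-distribʳ-sum)
  open ≈-Reasoning setoid

  -- Reflections

  sum-linear : ∀ {n} p q (f g : Vector Carrier n) →
               sum (λ i → p * f i + q * g i) ≈ p * sum f + q * sum g
  sum-linear p q f g = trans (∑-distrib-+ (λ i → p * f i) (λ i → q * g i))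
    (+-cong (sym (*-distribˡ-sum p f)) (sym (*-distribˡ-sum q g)))

  module _ {m : ℕ} where

    infix 4 _≋_
    _≋_ : Vector Carrier m → Vector Carrier m → Set
    x ≋ y = ∀ i → x i ≈ y i

    linearCombination : Carrier → Vector Carrier m → Carrier → Vector Carrier m → Vector Carrier m
    linearCombination p x q y i = p * x i + q * y i

    ⟨⟩-cong : ∀ {x x′ y y′ : Vector Carrier m} → x ≋ x′ → y ≋ y′ → ⟨ x , y ⟩ ≈ ⟨ x′ , y′ ⟩
    ⟨⟩-cong x≋x′ y≋y′ = sum-cong-≋ (λ i → *-cong (x≋x′ i) (y≋y′ i))

    ⟨⟩-comm : ∀ (x y : Vector Carrier m) → ⟨ x , y ⟩ ≈ ⟨ y , x ⟩
    ⟨⟩-comm x y = sum-cong-≋ (λ i → *-comm (x i) (y i))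

    ⟨⟩-linearˡ : ∀ p x q y z →
                 ⟨ linearCombination p x q y , z ⟩ ≈ p * ⟨ x , z ⟩ + q * ⟨ y , z ⟩
    ⟨⟩-linearˡ p x q y z = trans
      (sum-cong-≋ λ i → solve 5 (λ p q x y z → (p :* x :+ q :* y) :* z := p :* (x :* z) :+ q :* (y :* z))
        refl p q (x i) (y i) (z i))
      (sum-linear p q (λ i → x i * z i) (λ i → y i * z i))

    ⟨⟩-linearʳ : ∀ z p x q y →
                 ⟨ z , linearCombination p x q y ⟩ ≈ p * ⟨ z , x ⟩ + q * ⟨ z , y ⟩
    ⟨⟩-linearʳ z p x q y = trans (⟨⟩-comm z (linearCombination p x q y)) (trans (⟨⟩-linearˡ p x q y z)
      (+-cong (*-congˡ (⟨⟩-comm x z)) (*-congˡ (⟨⟩-comm y z))))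

    ⟨⟩-bilinear : ∀ p x q y r z s w →
      ⟨ linearCombination p x q y , linearCombination r z s w ⟩ ≈
      p * (r * ⟨ x , z ⟩ + s * ⟨ x , w ⟩) + q * (r * ⟨ y , z ⟩ + s * ⟨ y , w ⟩)
    ⟨⟩-bilinear p x q y r z s w = trans (⟨⟩-linearˡ p x q y _)
      (+-cong (*-congˡ (⟨⟩-linearʳ x r z s w)) (*-congˡ (⟨⟩-linearʳ y r z s w)))

    ⟨⟩-⊖ˡ : ∀ (x y z : Vector Carrier m) → ⟨ x ⊖ y , z ⟩ ≈ ⟨ x , z ⟩ - ⟨ y , z ⟩
    ⟨⟩-⊖ˡ x y z = begin
      ⟨ x ⊖ y , z ⟩                              ≈⟨ ⟨⟩-cong (λ i → x-y≈1x+-1y (x i) (y i)) (λ _ → refl) ⟩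
      ⟨ linearCombination 1# x (- 1#) y , z ⟩    ≈⟨ ⟨⟩-linearˡ 1# x (- 1#) y z ⟩
      1# * ⟨ x , z ⟩ + - 1# * ⟨ y , z ⟩          ≈⟨ sym (x-y≈1x+-1y _ _) ⟩
      ⟨ x , z ⟩ - ⟨ y , z ⟩                      ∎
      where
      x-y≈1x+-1y : ∀ x y → x - y ≈ 1# * x + - 1# * y
      x-y≈1x+-1y x y = sym (+-cong (*-identityˡ x) (-1*x≈-x y))

    -- Distances are expressed by inner products, so a map preserving the latter preserves the
    -- former.
    dist²≈ : ∀ (x y : Vector Carrier m) → dist² x y ≈ ⟨ x , x ⟩ - ⟨ x , y ⟩ - (⟨ x , y ⟩ - ⟨ y , y ⟩)
    dist²≈ x y = begin
      ⟨ x ⊖ y , x ⊖ y ⟩                        ≈⟨ ⟨⟩-⊖ˡ x y (x ⊖ y) ⟩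
      ⟨ x , x ⊖ y ⟩ - ⟨ y , x ⊖ y ⟩
        ≈⟨ +-cong (trans (⟨⟩-comm x (x ⊖ y)) (⟨⟩-⊖ˡ x y x)) (-‿cong (trans (⟨⟩-comm y (x ⊖ y)) (⟨⟩-⊖ˡ x y y))) ⟩
      ⟨ x , x ⟩ - ⟨ y , x ⟩ - (⟨ x , y ⟩ - ⟨ y , y ⟩)
        ≈⟨ +-congʳ (+-congˡ (-‿cong (⟨⟩-comm y x))) ⟩
      ⟨ x , x ⟩ - ⟨ x , y ⟩ - (⟨ x , y ⟩ - ⟨ y , y ⟩) ∎

    ⟨⟩-definite : ∀ (x : Vector Carrier m) → ⟨ x , x ⟩ ≈ 0# → ∀ i → x i ≈ 0#
    ⟨⟩-definite x ⟨x,x⟩≈0 i with x*y≈0⇒x≈0∨y≈0 (x i) (x i)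
      (sum≈0⇒terms≈0 (λ j → x j * x j) (λ j → square-nonneg (x j)) ⟨x,x⟩≈0 i)
    ... | inj₁ xi≈0 = xi≈0
    ... | inj₂ xi≈0 = xi≈0

    -- The reflection in the hyperplane orthogonal to u, where w is the
    -- inverse of ⟨ u , u ⟩.

    module Reflection (u : Vector Carrier m) (w : Carrier) (⟨u,u⟩w≈1 : ⟨ u , u ⟩ * w ≈ 1#) where

      shiftBy : Vector Carrier m → Carrier
      shiftBy x = - (fromℤ (+ 2) * (⟨ x , u ⟩ * w))

      reflect : Vector Carrier m → Vector Carrier m
      reflect x = linearCombination 1# x (shiftBy x) u

      reflect-isometric : ∀ x y → ⟨ reflect x , reflect y ⟩ ≈ ⟨ x , y ⟩
      reflect-isometric x y = begin
        ⟨ reflect x , reflect y ⟩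
          ≈⟨ ⟨⟩-bilinear 1# x (shiftBy x) u 1# y (shiftBy y) u ⟩
        1# * (1# * ⟨ x , y ⟩ + shiftBy y * ⟨ x , u ⟩) + shiftBy x * (1# * ⟨ u , y ⟩ + shiftBy y * ⟨ u , u ⟩)
          ≈⟨ +-cong (trans (*-identityˡ _) (+-congʳ (*-identityˡ _)))
                    (*-congˡ (+-congʳ (trans (*-identityˡ _) (⟨⟩-comm u y)))) ⟩
        (⟨ x , y ⟩ + shiftBy y * ⟨ x , u ⟩) + shiftBy x * (⟨ y , u ⟩ + shiftBy y * ⟨ u , u ⟩)
          -- The deviation from ⟨ x , y ⟩ is a multiple of ⟨ u , u ⟩ * w - 1, which vanishes.
          ≈⟨ solve 5 (λ e p q r w →
               let s = λ z → :- (con (+ 2) :* (z :* w)) in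
               (e :+ s q :* p) :+ s p :* (q :+ s q :* r) :=
               e :+ con (+ 4) :* (p :* q :* w) :* (r :* w :- con (+ 1)))
             refl ⟨ x , y ⟩ ⟨ x , u ⟩ ⟨ y , u ⟩ ⟨ u , u ⟩ w ⟩
        ⟨ x , y ⟩ + fromℤ (+ 4) * (⟨ x , u ⟩ * ⟨ y , u ⟩ * w) * (⟨ u , u ⟩ * w - fromℤ (+ 1))
          ≈⟨ +-congˡ (trans (*-congˡ (trans (+-cong ⟨u,u⟩w≈1 (-‿cong fromℤ-1)) (-‿inverseʳ 1#))) (zeroʳ _)) ⟩
        ⟨ x , y ⟩ + 0#   ≈⟨ +-identityʳ _ ⟩
        ⟨ x , y ⟩        ∎

      reflect-dist² : ∀ x y → dist² (reflect x) (reflect y) ≈ dist² x y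
      reflect-dist² x y = begin
        dist² (reflect x) (reflect y)  ≈⟨ dist²≈ (reflect x) (reflect y) ⟩
        _                              ≈⟨ +-cong (+-cong (reflect-isometric x x) (-‿cong (reflect-isometric x y)))
                                            (-‿cong (+-cong (reflect-isometric x y) (-‿cong (reflect-isometric y y)))) ⟩
        _                              ≈⟨ sym (dist²≈ x y) ⟩
        dist² x y                      ∎

      ⟨reflect⟩ : ∀ x z → ⟨ reflect x , z ⟩ ≈ ⟨ x , z ⟩ + shiftBy x * ⟨ u , z ⟩
      ⟨reflect⟩ x z = trans (⟨⟩-linearˡ 1# x (shiftBy x) u z) (+-congʳ (*-identityˡ _))

      shiftBy-reflect : ∀ x → shiftBy (reflect x) ≈ - shiftBy x
      shiftBy-reflect x = begin
        shiftBy (reflect x)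
          ≈⟨ -‿cong (*-congˡ (*-congʳ (⟨reflect⟩ x u))) ⟩
        - (fromℤ (+ 2) * ((⟨ x , u ⟩ + shiftBy x * ⟨ u , u ⟩) * w))
          ≈⟨ solve 3 (λ p r w →
               let s = λ z → :- (con (+ 2) :* (z :* w)) in
               s (p :+ s p :* r) := :- s p :+ con (+ 4) :* (p :* w) :* (r :* w :- con (+ 1)))
             refl ⟨ x , u ⟩ ⟨ u , u ⟩ w ⟩
        - shiftBy x + fromℤ (+ 4) * (⟨ x , u ⟩ * w) * (⟨ u , u ⟩ * w - fromℤ (+ 1))
          ≈⟨ +-congˡ (trans (*-congˡ (trans (+-cong ⟨u,u⟩w≈1 (-‿cong fromℤ-1)) (-‿inverseʳ 1#))) (zeroʳ _)) ⟩
        - shiftBy x + 0#  ≈⟨ +-identityʳ _ ⟩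
        - shiftBy x       ∎

      reflect-involutive : ∀ x → reflect (reflect x) ≋ x
      reflect-involutive x i = begin
        1# * (1# * x i + shiftBy x * u i) + shiftBy (reflect x) * u i
          ≈⟨ +-cong (trans (*-identityˡ _) (+-congʳ (*-identityˡ _))) (*-congʳ (shiftBy-reflect x)) ⟩
        (x i + shiftBy x * u i) + - shiftBy x * u i
          ≈⟨ solve 3 (λ x s u → (x :+ s :* u) :+ :- s :* u := x) refl (x i) (shiftBy x) (u i) ⟩
        x i ∎

    -- Equal norms give 2 ⟨ u , a ⟩ = ⟨ u , u ⟩, so reflecting x changes its product with a by
    -- exactly ⟨ b , x ⟩ - ⟨ a , x ⟩. The reflection thus exchanges a and b, in the form that power
    -- sums use.
    reflect-swap : ∀ a b w (⟨u,u⟩w≈1 : ⟨ a ⊖ b , a ⊖ b ⟩ * w ≈ 1#) → ⟨ a , a ⟩ ≈ ⟨ b , b ⟩ →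
                   ∀ x → ⟨ b , x ⟩ ≈ ⟨ a , Reflection.reflect (a ⊖ b) w ⟨u,u⟩w≈1 x ⟩
    reflect-swap a b w ⟨u,u⟩w≈1 a²≈b² x = sym (begin
      ⟨ a , reflect x ⟩                  ≈⟨ ⟨⟩-comm a (reflect x) ⟩
      ⟨ reflect x , a ⟩                  ≈⟨ ⟨reflect⟩ x a ⟩
      ⟨ x , a ⟩ + shiftBy x * ⟨ u , a ⟩
        ≈⟨ +-cong (⟨⟩-comm x a) (*-congʳ (-‿cong (*-congˡ (*-congʳ (trans (⟨⟩-comm x u) (⟨⟩-⊖ˡ a b x)))))) ⟩
      ⟨ a , x ⟩ + - (fromℤ (+ 2) * ((⟨ a , x ⟩ - ⟨ b , x ⟩) * w)) * ⟨ u , a ⟩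
        ≈⟨ solve 4 (λ p q w r → p :+ :- (con (+ 2) :* ((p :- q) :* w)) :* r
                := q :+ (p :- q) :* (con (+ 1) :- con (+ 2) :* r :* w)) refl ⟨ a , x ⟩ ⟨ b , x ⟩ w ⟨ u , a ⟩ ⟩
      ⟨ b , x ⟩ + (⟨ a , x ⟩ - ⟨ b , x ⟩) * (fromℤ (+ 1) - fromℤ (+ 2) * ⟨ u , a ⟩ * w)
        ≈⟨ +-congˡ (*-congˡ (+-cong fromℤ-1 (-‿cong (trans (*-congʳ 2⟨u,a⟩≈⟨u,u⟩) ⟨u,u⟩w≈1)))) ⟩
      ⟨ b , x ⟩ + (⟨ a , x ⟩ - ⟨ b , x ⟩) * (1# - 1#)
        ≈⟨ +-congˡ (trans (*-congˡ (-‿inverseʳ 1#)) (zeroʳ _)) ⟩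
      ⟨ b , x ⟩ + 0#  ≈⟨ +-identityʳ _ ⟩
      ⟨ b , x ⟩       ∎)
      where
      u = a ⊖ b
      open Reflection u w ⟨u,u⟩w≈1
      2⟨u,a⟩≈⟨u,u⟩ : fromℤ (+ 2) * ⟨ u , a ⟩ ≈ ⟨ u , u ⟩
      2⟨u,a⟩≈⟨u,u⟩ = begin
        fromℤ (+ 2) * ⟨ u , a ⟩   ≈⟨ *-congˡ (trans (⟨⟩-⊖ˡ a b a) (+-congˡ (-‿cong (⟨⟩-comm b a)))) ⟩
        fromℤ (+ 2) * (⟨ a , a ⟩ - ⟨ a , b ⟩)
          ≈⟨ solve 2 (λ p q → con (+ 2) :* (p :- q) := p :- q :- (q :- p)) refl ⟨ a , a ⟩ ⟨ a , b ⟩ ⟩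
        ⟨ a , a ⟩ - ⟨ a , b ⟩ - (⟨ a , b ⟩ - ⟨ a , a ⟩)  ≈⟨ +-congˡ (-‿cong (+-congˡ (-‿cong a²≈b²))) ⟩
        ⟨ a , a ⟩ - ⟨ a , b ⟩ - (⟨ a , b ⟩ - ⟨ b , b ⟩)  ≈⟨ sym (dist²≈ a b) ⟩
        ⟨ u , u ⟩ ∎

  -- Invariance of the integral under isometries

  module _ {ℓ : Level} where

    IsSup-resp : ∀ {P Q : Pred Carrier ℓ} {s} → P ⊆ Q → Q ⊆ P → IsSup P s → IsSup Q s
    IsSup-resp P⊆Q Q⊆P (ub , least) =
      (λ x∈Q → ub (Q⊆P x∈Q)) , λ u u-ub → least u (λ x∈P → u-ub (P⊆Q x∈P))

    IsInf-resp : ∀ {P Q : Pred Carrier ℓ} {s} → P ⊆ Q → Q ⊆ P → IsInf P s → IsInf Q s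
    IsInf-resp P⊆Q Q⊆P (lb , greatest) =
      (λ x∈Q → lb (Q⊆P x∈Q)) , λ l l-lb → greatest l (λ x∈P → l-lb (P⊆Q x∈P))

    IsSup-unique : ∀ {P : Pred Carrier ℓ} {s t} → IsSup P s → IsSup P t → s ≈ t
    IsSup-unique (s-ub , s-least) (t-ub , t-least) = ≤-antisym (s-least _ t-ub) (t-least _ s-ub)

  ^2-pos : ∀ {x} → 0# < x → 0# < x ^ 2
  ^2-pos 0<x = *-pos 0<x (*-pos 0<x 0<1)

  module _ {d : ℕ} where

    -- A predicate on Sphere d need not respect pointwise equality of points.

    Extensional : Pred (Pred (Sphere d) 0ℓ) 0ℓ
    Extensional A = ∀ {x y} → point x ≋ point y → x ∈ A → y ∈ A

    -- Coordinatewise equal points have distance 0, so each lies in every ball around the other.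
    Open⇒Extensional : ∀ {A} → Open A → Extensional A
    Open⇒Extensional open-A {x} {y} x≋y x∈A with open-A x x∈A
    ... | ε , 0<ε , ball⊆A = ball⊆A y
      (<-respˡ (sym (trans (⟨⟩-cong x⊖y≋0 x⊖y≋0) ⟨0,0⟩≈0)) (^2-pos 0<ε))
      where
      x⊖y≋0 : point x ⊖ point y ≋ λ _ → 0#
      x⊖y≋0 i = trans (+-congʳ (x≋y i)) (-‿inverseʳ _)
      ⟨0,0⟩≈0 : ⟨ (λ _ → 0#) , (λ (_ : Fin (suc d)) → 0#) ⟩ ≈ 0#
      ⟨0,0⟩≈0 = trans (sum-cong-≋ {suc d} λ _ → zeroˡ 0#) (sum-replicate-zero (suc d))

    Borel⇒Extensional : ∀ {A} → Borel A → Extensional A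
    Borel⇒Extensional (open-set open-A)       = Open⇒Extensional open-A
    Borel⇒Extensional (complement A-Borel) x≋y x∉A y∈A =
      x∉A (Borel⇒Extensional A-Borel (λ i → sym (x≋y i)) y∈A)
    Borel⇒Extensional (union A-Borel) x≋y (k , x∈Ak) = k , Borel⇒Extensional (A-Borel k) x≋y x∈Ak
    Borel⇒Extensional (resp (A⊆B , B⊆A) A-Borel) x≋y x∈B =
      A⊆B (Borel⇒Extensional A-Borel x≋y (B⊆A x∈B))

    -- Being its own inverse, such a map lets pullback lemmas serve in both directions.
    record InvolutiveIsometry : Set where
      field
        to         : Sphere d → Sphere d
        isometric  : ∀ x y → dist² (point (to x)) (point (to y)) ≈ dist² (point x) (point y)
        involutive : ∀ x → point (to (to x)) ≋ point x

    module _ (R : InvolutiveIsometry) where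

      open InvolutiveIsometry R

      Cover-preimage : ∀ {A δ c} → Cover A δ c → Cover (A ∘ to) δ c
      Cover-preimage 𝒰 = record
        { part     = λ k → part k ∘ to
        ; r        = r
        ; covers   = covers
        ; 0≤r      = 0≤r
        ; r≤δ      = r≤δ
        ; diameter = λ k x∈ y∈ → ≤-respˡ-≈ (isometric _ _) (diameter k x∈ y∈)
        ; cost     = cost
        }
        where open Cover 𝒰

      -- Pulling back a second time covers the preimage of A under `to ∘ to`, which contains A
      -- because A is extensional.
      Cover-preimage⁻¹ : ∀ {A δ c} → Extensional A → Cover (A ∘ to) δ c → Cover A δ c
      Cover-preimage⁻¹ A-ext 𝒰 = record
        { part     = part
        ; r        = r
        ; covers   = λ {x} x∈A → covers (A-ext (λ i → sym (involutive x i)) x∈A)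
        ; 0≤r      = 0≤r
        ; r≤δ      = r≤δ
        ; diameter = diameter
        ; cost     = cost
        }
        where open Cover (Cover-preimage 𝒰)

      IsHausdorffMeasure-preimage : ∀ {A h} → Extensional A →
        IsHausdorffMeasure A h → IsHausdorffMeasure (A ∘ to) h
      IsHausdorffMeasure-preimage A-ext = IsSup-resp
        (λ (δ , 0<δ , inf) → δ , 0<δ , IsInf-resp Cover-preimage (Cover-preimage⁻¹ A-ext) inf)
        (λ (δ , 0<δ , inf) → δ , 0<δ , IsInf-resp (Cover-preimage⁻¹ A-ext) Cover-preimage inf)

      IsMeasure-preimage : ∀ {A v} → Extensional A → IsMeasure A v → IsMeasure (A ∘ to) v
      IsMeasure-preimage A-ext (a , s , A-a , U-s , v≈) =
        a , s , IsHausdorffMeasure-preimage A-ext A-a , U-s , v≈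

      Borel-preimage : ∀ {A} → Borel A → Borel (A ∘ to)
      Borel-preimage (open-set open-A) = open-set λ x Rx∈A →
        let ε , 0<ε , ball⊆A = open-A (to x) Rx∈A in
        ε , 0<ε , λ y d<ε² → ball⊆A (to y) (<-respˡ (sym (isometric x y)) d<ε²)
      Borel-preimage (complement A-Borel) = complement (Borel-preimage A-Borel)
      Borel-preimage (union A-Borel)      = union (λ k → Borel-preimage (A-Borel k))
      Borel-preimage (resp (A⊆B , B⊆A) A-Borel) = resp (A⊆B , B⊆A) (Borel-preimage A-Borel)

      SimpleFunction-preimage : SimpleFunction {d} → SimpleFunction {d}
      SimpleFunction-preimage φ = record
        { piece     = λ i → piece i ∘ to
        ; partition = λ x → partition (to x)
        ; borel     = λ i → Borel-preimage (borel i)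
        ; value     = value
        ; σ         = σ
        ; σ-measure = λ i → IsMeasure-preimage (Borel⇒Extensional (borel i)) (σ-measure i)
        }
        where open SimpleFunction φ

      LowerSum-preimage : ∀ {f g} → (∀ x → g x ≈ f (to x)) → LowerSum f ⊆ LowerSum g
      LowerSum-preimage g≈f∘R (φ , φ≤f , s≈) =
        SimpleFunction-preimage φ , (λ i x x∈ → ≤-respʳ-≈ (sym (g≈f∘R x)) (φ≤f i (to x) x∈)) , s≈

      UpperSum-preimage : ∀ {f g} → (∀ x → g x ≈ f (to x)) → UpperSum f ⊆ UpperSum g
      UpperSum-preimage g≈f∘R (φ , f≤φ , s≈) =
        SimpleFunction-preimage φ , (λ i x x∈ → ≤-respˡ-≈ (sym (g≈f∘R x)) (f≤φ i (to x) x∈)) , s≈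

      -- Each hypothesis gives one inclusion between the lower sums and between the upper sums of f
      -- and g. Both are assumed because `to ∘ to` is the identity only coordinatewise, and f need
      -- not respect that equality.
      IsIntegral-invariant : ∀ {f g v} → (∀ x → g x ≈ f (to x)) → (∀ x → f x ≈ g (to x)) →
                             IsIntegral f v → IsIntegral g v
      IsIntegral-invariant g≈f∘R f≈g∘R (sup , inf) =
        IsSup-resp (LowerSum-preimage g≈f∘R) (LowerSum-preimage f≈g∘R) sup ,
        IsInf-resp (UpperSum-preimage g≈f∘R) (UpperSum-preimage f≈g∘R) inf

  -- Powers of linear forms as polynomials

  sumℕ-updateAt-suc : ∀ {m} (e : Vector ℕ m) i → sumℕ (updateAt e i suc) ≡ suc (sumℕ e)
  sumℕ-updateAt-suc e zero    = ≡.refl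
  sumℕ-updateAt-suc e (suc i) = ≡.trans
    (≡.cong (e zero ℕ.+_) (sumℕ-updateAt-suc (e ∘ suc) i)) (ℕ.+-suc (e zero) _)

  product-updateAt-suc : ∀ {m} (x : Vector Carrier m) (e : Vector ℕ m) i →
    product (λ j → x j ^ updateAt e i suc j) ≈ x i * product (λ j → x j ^ e j)
  product-updateAt-suc x e zero    = *-assoc _ _ _
  product-updateAt-suc x e (suc i) = trans
    (*-congˡ (product-updateAt-suc (x ∘ suc) (e ∘ suc) i))
    (solve 3 (λ a b c → a :* (b :* c) := b :* (a :* c)) refl _ (x (suc i)) _)

  module _ {m : ℕ} where

    multiplyMonomial : ∀ {τ} → Carrier → Fin m → Monomial m τ → Monomial m (suc τ)
    multiplyMonomial c i q = record
      { coefficient = c * coefficient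
      ; exponent    = updateAt exponent i suc
      ; degree≤τ    = ≡.subst (ℕ._≤ _) (≡.sym (sumℕ-updateAt-suc exponent i)) (s≤s degree≤τ)
      }
      where open Monomial q

    evalMonomial-multiply : ∀ {τ} c i (q : Monomial m τ) x →
      evalMonomial (multiplyMonomial c i q) x ≈ c * x i * evalMonomial q x
    evalMonomial-multiply c i q x = trans
      (*-congˡ (product-updateAt-suc x exponent i))
      (solve 4 (λ c d xi P → (c :* d) :* (xi :* P) := c :* xi :* (d :* P)) refl
        c coefficient (x i) _)
      where open Monomial q

    multiplyLinear : ∀ {τ} → Vector Carrier m → Polynomial m τ → Polynomial m (suc τ)
    multiplyLinear a p = concat (tabulate λ i → map (multiplyMonomial (a i) i) p)

    eval-++ : ∀ {τ} (p q : Polynomial m τ) x → eval (p ++ q) x ≈ eval p x + eval q x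
    eval-++ []      q x = sym (+-identityˡ _)
    eval-++ (t ∷ p) q x = trans (+-congˡ (eval-++ p q x)) (sym (+-assoc _ _ _))

    eval-concat-tabulate : ∀ {τ n} (p : Fin n → Polynomial m τ) x →
                           eval (concat (tabulate p)) x ≈ sum (λ i → eval (p i) x)
    eval-concat-tabulate {n = zero}  p x = refl
    eval-concat-tabulate {n = suc n} p x = trans (eval-++ (p zero) _ x)
      (+-congˡ (eval-concat-tabulate (p ∘ suc) x))

    eval-map-multiply : ∀ {τ} c i (p : Polynomial m τ) x →
      eval (map (multiplyMonomial c i) p) x ≈ c * x i * eval p x
    eval-map-multiply c i []      x = sym (zeroʳ _)
    eval-map-multiply c i (q ∷ p) x = trans
      (+-cong (evalMonomial-multiply c i q x) (eval-map-multiply c i p x)) (sym (distribˡ _ _ _))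

    eval-multiplyLinear : ∀ {τ} a (p : Polynomial m τ) x →
      eval (multiplyLinear a p) x ≈ ⟨ a , x ⟩ * eval p x
    eval-multiplyLinear a p x = begin
      eval (multiplyLinear a p) x
        ≈⟨ eval-concat-tabulate (λ i → map (multiplyMonomial (a i) i) p) x ⟩
      sum (λ i → eval (map (multiplyMonomial (a i) i) p) x)
        ≈⟨ sum-cong-≋ (λ i → eval-map-multiply (a i) i p x) ⟩
      sum (λ i → a i * x i * eval p x)
        ≈⟨ sym (*-distribʳ-sum (eval p x) (λ i → a i * x i)) ⟩
      ⟨ a , x ⟩ * eval p x ∎

    -- The slack e raises the formal degree bound, so that every k ≤ 11 meets the single bound fixed
    -- by `IsDesign`.
    linearPower : Vector Carrier m → ∀ k e → Polynomial m (k ℕ.+ e)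
    linearPower a zero    e = record
      { coefficient = 1#
      ; exponent    = const 0
      ; degree≤τ    = ≡.subst (ℕ._≤ e) (≡.sym (sumℕ-replicate-zero m)) z≤n
      } ∷ []
    linearPower a (suc k) e = multiplyLinear a (linearPower a k e)

    eval-linearPower : ∀ a k e x → eval (linearPower a k e) x ≈ ⟨ a , x ⟩ ^ k
    eval-linearPower a zero    e x = trans (+-identityʳ _) (trans (*-identityˡ _)
      (product-replicate-one m))
    eval-linearPower a (suc k) e x = trans (eval-multiplyLinear a (linearPower a k e) x)
      (*-congˡ (eval-linearPower a k e x))

  -- Norm invariance of the power sums of a design

  module _ {d N : ℕ} (C : Code d N) where

    pt : Fin N → Vector Carrier (suc d)
    pt i = point (Injection.to C i)

    powerSum : ℕ → Vector Carrier (suc d) → Carrier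
    powerSum k a = sum (λ i → ⟨ a , pt i ⟩ ^ k)

    1/N≉0 : .{{_ : NonZero N}} → ¬ (1/ N ≈ 0#)
    1/N≉0 1/N≈0 = 0≉1 (begin
      0#             ≈⟨ sym (zeroʳ (fromℕ N)) ⟩
      fromℕ N * 0#   ≈⟨ *-congˡ (sym 1/N≈0) ⟩
      fromℕ N * 1/ N ≈⟨ ⁻¹-inverse (fromℕ N) (λ N≈0 → ℕ.≢-nonZero⁻¹ N (ι≈0⇒≡0 N N≈0)) ⟩
      1#             ∎)

    -- The averages of p and q over C are their integrals. By invariance both are suprema of the
    -- same lower sums, hence equal, and 1/ N cancels.
    design-invariant : .{{_ : NonZero N}} → ∀ {τ} → IsDesign C τ → (R : InvolutiveIsometry) (p q : Polynomial (suc d) τ) →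
      (∀ x → eval q (point x) ≈ eval p (point (InvolutiveIsometry.to R x))) →
      (∀ x → eval p (point x) ≈ eval q (point (InvolutiveIsometry.to R x))) →
      sum (λ i → eval p (pt i)) ≈ sum (λ i → eval q (pt i))
    design-invariant design R p q q≈p∘R p≈q∘R = *-cancelˡ 1/N≉0
      (IsSup-unique (proj₁ (IsIntegral-invariant R q≈p∘R p≈q∘R (design p))) (proj₁ (design q)))

    powerSum-cong : ∀ k {a b} → a ≋ b → powerSum k a ≈ powerSum k b
    powerSum-cong k a≋b = sum-cong-≋ {N} λ i → ^-congˡ k (⟨⟩-cong {y = pt i} a≋b (λ _ → refl))

    -- If a - b has norm zero, then a and b coincide. Otherwise the reflection along a - b exchanges
    -- them and carries one power of a linear form to the other.
    powerSum-norm : .{{_ : NonZero N}} → ∀ {k e} → IsDesign C (k ℕ.+ e) → ∀ a b → ⟨ a , a ⟩ ≈ ⟨ b , b ⟩ →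
                    powerSum k a ≈ powerSum k b
    powerSum-norm {k} {e} design a b a²≈b² with ⟨ a ⊖ b , a ⊖ b ⟩ ≟ 0#
    ... | yes u²≈0 = powerSum-cong k λ i → x-y≈0⇒x≈y (⟨⟩-definite (a ⊖ b) u²≈0 i)
    ... | no  u²≉0 = begin
      powerSum k a                              ≈⟨ sum-cong-≋ (λ i → sym (eval-linearPower a k e (pt i))) ⟩
      sum (λ i → eval (linearPower a k e) (pt i))
        ≈⟨ design-invariant design R (linearPower a k e) (linearPower b k e) b≈a∘R a≈b∘R ⟩
      sum (λ i → eval (linearPower b k e) (pt i)) ≈⟨ sum-cong-≋ (λ i → eval-linearPower b k e (pt i)) ⟩
      powerSum k b                              ∎
      where
      w = ⟨ a ⊖ b , a ⊖ b ⟩ ⁻¹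
      u²w≈1 = ⁻¹-inverse ⟨ a ⊖ b , a ⊖ b ⟩ u²≉0
      open Reflection (a ⊖ b) w u²w≈1
      R : InvolutiveIsometry {d}
      R = record
        { to         = λ x → reflect (point x) , trans (reflect-isometric (point x) (point x)) (unit x)
        ; isometric  = λ x y → reflect-dist² (point x) (point y)
        ; involutive = λ x → reflect-involutive (point x)
        }
      swap : ∀ x → ⟨ b , x ⟩ ≈ ⟨ a , reflect x ⟩
      swap = reflect-swap a b w u²w≈1 a²≈b²
      b≈a∘R : ∀ x → eval (linearPower b k e) (point x) ≈ eval (linearPower a k e) (reflect (point x))
      b≈a∘R x = trans (eval-linearPower b k e (point x)) (trans (^-congˡ k (swap (point x)))
        (sym (eval-linearPower a k e (reflect (point x)))))
      a≈b∘R : ∀ x → eval (linearPower a k e) (point x) ≈ eval (linearPower b k e) (reflect (point x))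
      a≈b∘R x = trans (eval-linearPower a k e (point x)) (trans (^-congˡ k
        (trans (⟨⟩-cong {x = a} (λ _ → refl) (λ i → sym (reflect-involutive (point x) i)))
          (sym (swap (reflect (point x))))))
        (sym (eval-linearPower b k e (reflect (point x)))))

  -- Moments of a design

  fromℤ-^ : ∀ i k → fromℤ (i ℤ.^ k) ≈ fromℤ i ^ k
  fromℤ-^ i zero    = fromℤ-1
  fromℤ-^ i (suc k) = trans (fromℤ-* i (i ℤ.^ k)) (*-congˡ (fromℤ-^ i k))

  sum-const : ∀ n x → sum {n} (λ _ → x) ≈ fromℤ (+ n) * x
  sum-const n x = begin
    sum {n} (λ _ → x)       ≈⟨ sum-cong-≋ {n} (λ _ → sym (*-identityˡ x)) ⟩
    sum {n} (λ _ → 1# * x)  ≈⟨ sym (*-distribʳ-sum {n} x (λ _ → 1#)) ⟩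
    sum {n} (λ _ → 1#) * x  ≈⟨ *-congʳ (trans (sum-replicate n) (sym (fromℤ-pos n))) ⟩
    fromℤ (+ n) * x         ∎

  basis : ∀ {m} → Fin m → Vector Carrier m
  basis zero    zero    = 1#
  basis zero    (suc j) = 0#
  basis (suc i) zero    = 0#
  basis (suc i) (suc j) = basis i j

  ⟨basis,⟩ : ∀ {m} i (x : Vector Carrier m) → ⟨ basis i , x ⟩ ≈ x i
  ⟨basis,⟩ {suc m} zero x = begin
    1# * x zero + sum (λ i → 0# * x (suc i))
      ≈⟨ +-cong (*-identityˡ _) (trans (sum-cong-≋ {m} λ i → zeroˡ (x (suc i))) (sum-replicate-zero m)) ⟩
    x zero + 0#  ≈⟨ +-identityʳ _ ⟩
    x zero       ∎
  ⟨basis,⟩ (suc i) x = trans (+-cong (zeroˡ _) (⟨basis,⟩ i (x ∘ suc))) (+-identityˡ _)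

  basis-diagonal : ∀ {m} (i : Fin m) → basis i i ≈ 1#
  basis-diagonal zero    = refl
  basis-diagonal (suc i) = basis-diagonal i

  ⟨⟩-scaleˡ : ∀ {m} c (a x : Vector Carrier m) → ⟨ (λ i → c * a i) , x ⟩ ≈ c * ⟨ a , x ⟩
  ⟨⟩-scaleˡ c a x = trans (sum-cong-≋ λ i → *-assoc c (a i) (x i))
    (sym (*-distribˡ-sum c (λ i → a i * x i)))

  ⟨⟩-scale : ∀ {m} c (a : Vector Carrier m) → ⟨ (λ i → c * a i) , (λ i → c * a i) ⟩ ≈ c * c * ⟨ a , a ⟩
  ⟨⟩-scale c a = begin
    ⟨ ca , ca ⟩           ≈⟨ ⟨⟩-scaleˡ c a ca ⟩
    c * ⟨ a , ca ⟩        ≈⟨ *-congˡ (trans (⟨⟩-comm a ca) (⟨⟩-scaleˡ c a a)) ⟩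
    c * (c * ⟨ a , a ⟩)   ≈⟨ sym (*-assoc c c _) ⟩
    c * c * ⟨ a , a ⟩     ∎
    where ca = λ i → c * a i

  -- Constants, including zero and - q, are images under `fromℤ`, so that this agrees definitionally
  -- with the evaluation of `:weightedPowers` by the solver.
  weightedPowers : ℕ → List PowerPair → Carrier → Carrier → Carrier
  weightedPowers k []       x y = fromℤ (+ 0)
  weightedPowers k (t ∷ ts) x y =
    fromℤ weight * ((fromℤ (+ p) * x + fromℤ (+ q) * y) ^ k + (fromℤ (+ p) * x + fromℤ (ℤ.- + q) * y) ^ k)
    + weightedPowers k ts x y
    where open PowerPair t

  :weightedPowers : ∀ {n} → ℕ → List PowerPair → Solver.Polynomial n → Solver.Polynomial n → Solver.Polynomial n
  :weightedPowers k []       x y = con (+ 0)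
  :weightedPowers k (t ∷ ts) x y =
    con weight :* ((con (+ p) :* x :+ con (+ q) :* y) :^ k :+ (con (+ p) :* x :+ con (ℤ.- + q) :* y) :^ k)
    :+ :weightedPowers k ts x y
    where open PowerPair t

  -- By rotation invariance such an identity expresses the integral of x ^ k * y ^ 2
  -- by that of x ^ (2 + k).

  record PowerIdentity (k : ℕ) : Set where
    field
      scale       : ℤ
      powers      : List PowerPair
      pythagorean : All Pythagorean powers
      identity    : ∀ x y → fromℤ scale * (x ^ k * (y * y)) ≈ weightedPowers (2 ℕ.+ k) powers x y

  module _ {d N : ℕ} .{{_ : NonZero N}} (C : Code d N) where

    private
      e₀ : Vector Carrier (suc d)
      e₀ = basis zero

      eₛ : Fin d → Vector Carrier (suc d)
      eₛ i = basis (suc i)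

    powerSum-scale : ∀ k c a → powerSum C k (λ i → fromℤ c * a i) ≈ fromℤ (c ℤ.^ k) * powerSum C k a
    powerSum-scale k c a = begin
      powerSum C k (λ i → fromℤ c * a i)
        ≈⟨ sum-cong-≋ {N} (λ j → trans (^-congˡ k (⟨⟩-scaleˡ (fromℤ c) a (pt C j)))
             (trans (^-distrib-* (fromℤ c) ⟨ a , pt C j ⟩ k) (*-congʳ (sym (fromℤ-^ c k))))) ⟩
      sum (λ j → fromℤ (c ℤ.^ k) * ⟨ a , pt C j ⟩ ^ k)
        ≈⟨ sym (*-distribˡ-sum (fromℤ (c ℤ.^ k)) (λ j → ⟨ a , pt C j ⟩ ^ k)) ⟩
      fromℤ (c ℤ.^ k) * powerSum C k a ∎

    -- The sum is not divided by N. By norm invariance the first basis vector represents all unit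
    -- vectors.
    moment : ℕ → Carrier
    moment k = powerSum C k e₀

    moment≈ : ∀ k → moment k ≈ sum (λ j → pt C j zero ^ k)
    moment≈ k = sum-cong-≋ {N} λ j → ^-congˡ k (⟨basis,⟩ zero (pt C j))

    moment-0 : moment 0 ≈ fromℤ (+ N)
    moment-0 = trans (sum-const N 1#) (*-identityʳ _)

    e₀-unit : ⟨ e₀ , e₀ ⟩ ≈ 1#
    e₀-unit = ⟨basis,⟩ zero e₀

    powerSum-scaled-unit : ∀ {k e} → IsDesign C (k ℕ.+ e) → ∀ c a → ⟨ a , a ⟩ ≈ 1# →
      powerSum C k (λ i → fromℤ c * a i) ≈ fromℤ (c ℤ.^ k) * moment k
    powerSum-scaled-unit {k} {e} design c a a²≈1 = trans
      (powerSum-norm C {k} {e} design (λ i → fromℤ c * a i) (λ i → fromℤ c * e₀ i)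
        (trans (⟨⟩-scale (fromℤ c) a) (trans (*-congˡ (trans a²≈1 (sym e₀-unit)))
          (sym (⟨⟩-scale (fromℤ c) e₀)))))
      (powerSum-scale k c e₀)

    -- A vector and its negative have the same norm, so an odd moment equals its own negative.
    -- Oddness is phrased as (-1) ^ k = -1, which computes for numerals.
    moment-odd : ∀ {k e} → IsDesign C (k ℕ.+ e) → -[1+ 0 ] ℤ.^ k ≡ -[1+ 0 ] → moment k ≈ 0#
    moment-odd {k} {e} design k-odd = *-cancelˡ (fromℤ-nonzero {+ 2} λ ()) (begin
      fromℤ (+ 2) * moment k
        ≈⟨ solve 1 (λ m → con (+ 2) :* m := con (+ 1) :* m :- con -[1+ 0 ] :* m) refl (moment k) ⟩
      fromℤ (+ 1) * moment k - fromℤ -[1+ 0 ] * moment k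
        ≈⟨ +-cong (sym (scaled (+ 1) 1²)) (-‿cong (trans (*-congʳ (fromℤ-cong-≡ (≡.sym k-odd))) (sym (scaled′ -[1+ 0 ])))) ⟩
      powerSum C k (λ i → fromℤ (+ 1) * e₀ i) - powerSum C k (λ i → fromℤ -[1+ 0 ] * e₀ i)
        ≈⟨ +-congʳ (powerSum-norm C {k} {e} design (λ i → fromℤ (+ 1) * e₀ i) (λ i → fromℤ -[1+ 0 ] * e₀ i)
             (trans (⟨⟩-scale (fromℤ (+ 1)) e₀) (trans (*-congʳ (trans (sym (fromℤ-* (+ 1) (+ 1))) (fromℤ-* -[1+ 0 ] -[1+ 0 ])))
               (sym (⟨⟩-scale (fromℤ -[1+ 0 ]) e₀))))) ⟩
      _ - _ ≈⟨ -‿inverseʳ _ ⟩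
      0#  ≈⟨ sym (zeroʳ _) ⟩
      fromℤ (+ 2) * 0# ∎)
      where
      scaled′ : ∀ c → powerSum C k (λ i → fromℤ c * e₀ i) ≈ fromℤ (c ℤ.^ k) * moment k
      scaled′ c = powerSum-scale k c e₀
      1² : (+ 1) ℤ.^ k ≡ + 1
      1² = ℤ.^-zeroˡ k
      scaled : ∀ c → c ℤ.^ k ≡ c → powerSum C k (λ i → fromℤ c * e₀ i) ≈ fromℤ c * moment k
      scaled c eq = trans (scaled′ c) (*-congʳ (fromℤ-cong-≡ eq))

    -- The form p x + q y is the product with a vector that has the norm of r times the first basis
    -- vector.
    sum-pythagorean-power : ∀ {k e} → IsDesign C (k ℕ.+ e) → ∀ i p q r → p ℤ.* p ℤ.+ q ℤ.* q ≡ r ℤ.* r →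
      sum (λ j → (fromℤ p * pt C j zero + fromℤ q * pt C j (suc i)) ^ k) ≈ fromℤ (r ℤ.^ k) * moment k
    sum-pythagorean-power {k} {e} design i p q r p²+q²≡r² = begin
      sum (λ j → (fromℤ p * pt C j zero + fromℤ q * pt C j (suc i)) ^ k)
        ≈⟨ sum-cong-≋ {N} (λ j → ^-congˡ k (sym (trans (⟨⟩-linearˡ (fromℤ p) e₀ (fromℤ q) (eₛ i) (pt C j))
             (+-cong (*-congˡ (⟨basis,⟩ zero (pt C j))) (*-congˡ (⟨basis,⟩ (suc i) (pt C j))))))) ⟩
      powerSum C k v
        ≈⟨ powerSum-norm C {k} {e} design v (λ i → fromℤ r * e₀ i) v²≈r² ⟩
      powerSum C k (λ i → fromℤ r * e₀ i)
        ≈⟨ powerSum-scale k r e₀ ⟩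
      fromℤ (r ℤ.^ k) * moment k ∎
      where
      v = linearCombination (fromℤ p) e₀ (fromℤ q) (eₛ i)
      v²≈r² : ⟨ v , v ⟩ ≈ ⟨ (λ i → fromℤ r * e₀ i) , (λ i → fromℤ r * e₀ i) ⟩
      v²≈r² = begin
        ⟨ v , v ⟩
          ≈⟨ ⟨⟩-bilinear (fromℤ p) e₀ (fromℤ q) (eₛ i) (fromℤ p) e₀ (fromℤ q) (eₛ i) ⟩
        fromℤ p * (fromℤ p * ⟨ e₀ , e₀ ⟩ + fromℤ q * ⟨ e₀ , eₛ i ⟩) +
        fromℤ q * (fromℤ p * ⟨ eₛ i , e₀ ⟩ + fromℤ q * ⟨ eₛ i , eₛ i ⟩)
          ≈⟨ +-cong
               (*-congˡ (+-cong (*-congˡ (⟨basis,⟩ zero e₀)) (*-congˡ (⟨basis,⟩ zero (eₛ i)))))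
               (*-congˡ (+-cong (*-congˡ (⟨basis,⟩ (suc i) e₀))
                 (*-congˡ (trans (⟨basis,⟩ (suc i) (eₛ i)) (basis-diagonal (suc i)))))) ⟩
        fromℤ p * (fromℤ p * 1# + fromℤ q * 0#) + fromℤ q * (fromℤ p * 0# + fromℤ q * 1#)
          ≈⟨ +-cong (*-congˡ (trans (+-cong (*-identityʳ _) (zeroʳ _)) (+-identityʳ _)))
                    (*-congˡ (trans (+-cong (zeroʳ _) (*-identityʳ _)) (+-identityˡ _))) ⟩
        fromℤ p * fromℤ p + fromℤ q * fromℤ q
          ≈⟨ sym (trans (fromℤ-+ (p ℤ.* p) (q ℤ.* q)) (+-cong (fromℤ-* p p) (fromℤ-* q q))) ⟩
        fromℤ (p ℤ.* p ℤ.+ q ℤ.* q)  ≈⟨ fromℤ-cong-≡ p²+q²≡r² ⟩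
        fromℤ (r ℤ.* r)              ≈⟨ trans (fromℤ-* r r) (sym (*-identityʳ _)) ⟩
        fromℤ r * fromℤ r * 1#       ≈⟨ *-congˡ (sym e₀-unit) ⟩
        fromℤ r * fromℤ r * ⟨ e₀ , e₀ ⟩ ≈⟨ sym (⟨⟩-scale (fromℤ r) e₀) ⟩
        _ ∎

    sum-weightedPowers : ∀ {k e} → IsDesign C (k ℕ.+ e) → ∀ i ts → All Pythagorean ts →
      sum (λ j → weightedPowers k ts (pt C j zero) (pt C j (suc i))) ≈ fromℤ (totalWeight k ts) * moment k
    sum-weightedPowers design i [] [] = trans (sum-const N _)
      (trans (*-comm _ _) (trans (*-congʳ fromℤ-0) (trans (zeroˡ _) (sym (trans (*-congʳ fromℤ-0) (zeroˡ _))))))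
    sum-weightedPowers {k} {e} design i (t ∷ ts) (t-pyth ∷ ts-pyth) = begin
      sum (λ j → fromℤ weight * (f⁺ j + f⁻ j) + g j)
        ≈⟨ ∑-distrib-+ (λ j → fromℤ weight * (f⁺ j + f⁻ j)) g ⟩
      sum (λ j → fromℤ weight * (f⁺ j + f⁻ j)) + sum g
        ≈⟨ +-cong (trans (sym (*-distribˡ-sum (fromℤ weight) (λ j → f⁺ j + f⁻ j)))
             (*-congˡ (trans (∑-distrib-+ f⁺ f⁻) (+-cong
               (sum-pythagorean-power {k} {e} design i (+ p) (+ q) (+ r) p²+q²≡r²)
               (sum-pythagorean-power {k} {e} design i (+ p) (ℤ.- + q) (+ r) p²+[-q]²≡r²)))))
             (sum-weightedPowers {k} {e} design i ts ts-pyth) ⟩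
      fromℤ weight * (fromℤ rᵏ * moment k + fromℤ rᵏ * moment k) + fromℤ (totalWeight k ts) * moment k
        ≈⟨ solve 4 (λ w r t m → w :* (r :* m :+ r :* m) :+ t :* m := (w :* (con (+ 2) :* r) :+ t) :* m) refl
             (fromℤ weight) (fromℤ rᵏ) (fromℤ (totalWeight k ts)) (moment k) ⟩
      (fromℤ weight * (fromℤ (+ 2) * fromℤ rᵏ) + fromℤ (totalWeight k ts)) * moment k
        ≈⟨ *-congʳ (sym (trans (fromℤ-+ (weight ℤ.* (+ 2 ℤ.* rᵏ)) (totalWeight k ts))
             (+-congʳ (trans (fromℤ-* weight (+ 2 ℤ.* rᵏ)) (*-congˡ (fromℤ-* (+ 2) rᵏ)))))) ⟩
      fromℤ (totalWeight k (t ∷ ts)) * moment k ∎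
      where
      open PowerPair t
      rᵏ = (+ r) ℤ.^ k
      f⁺ f⁻ g : Vector Carrier N
      f⁺ j = (fromℤ (+ p) * pt C j zero + fromℤ (+ q) * pt C j (suc i)) ^ k
      f⁻ j = (fromℤ (+ p) * pt C j zero + fromℤ (ℤ.- + q) * pt C j (suc i)) ^ k
      g j = weightedPowers k ts (pt C j zero) (pt C j (suc i))
      p²+q²≡r² : + p ℤ.* + p ℤ.+ + q ℤ.* + q ≡ + r ℤ.* + r
      p²+q²≡r² = ≡.trans (≡.sym (≡.cong₂ ℤ._+_ (ℤ.pos-* p p) (ℤ.pos-* q q)))
        (≡.trans (≡.cong +_ t-pyth) (ℤ.pos-* r r))
      p²+[-q]²≡r² : + p ℤ.* + p ℤ.+ ℤ.- + q ℤ.* ℤ.- + q ≡ + r ℤ.* + r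
      p²+[-q]²≡r² = ≡.trans (≡.cong (ℤ._+_ (+ p ℤ.* + p)) [-q]²≡q²) p²+q²≡r²
        where
        [-q]²≡q² : ℤ.- + q ℤ.* ℤ.- + q ≡ + q ℤ.* + q
        [-q]²≡q² = ≡.trans (≡.sym (ℤ.neg-distribˡ-* (+ q) (ℤ.- + q)))
          (≡.trans (≡.cong ℤ.-_ (≡.sym (ℤ.neg-distribʳ-* (+ q) (+ q)))) (ℤ.neg-involutive (+ q ℤ.* + q)))

    -- Multiply x ^ k by 1 = x ^ 2 + Σ y ^ 2, with y running over the d other coordinates, and
    -- rewrite each x ^ k * y ^ 2 by the identity. Every such coordinate contributes the same total
    -- weight.
    moment-recurrence : ∀ {k e} → IsDesign C (2 ℕ.+ k ℕ.+ e) → (I : PowerIdentity k) →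
      let open PowerIdentity I in
      fromℤ scale * moment k ≈ fromℤ (scale ℤ.+ + d ℤ.* totalWeight (2 ℕ.+ k) powers) * moment (2 ℕ.+ k)
    moment-recurrence {k} {e} design I = begin
      fromℤ scale * moment k
        ≈⟨ *-congˡ (moment≈ k) ⟩
      fromℤ scale * sum (λ j → X j ^ k)
        ≈⟨ *-distribˡ-sum (fromℤ scale) (λ j → X j ^ k) ⟩
      sum (λ j → fromℤ scale * X j ^ k)
        ≈⟨ sum-cong-≋ {N} expand ⟩
      sum (λ j → fromℤ scale * X j ^ (2 ℕ.+ k) + sum (λ i → W j i))
        ≈⟨ ∑-distrib-+ (λ j → fromℤ scale * X j ^ (2 ℕ.+ k)) (λ j → sum (λ i → W j i)) ⟩
      sum (λ j → fromℤ scale * X j ^ (2 ℕ.+ k)) + sum (λ j → sum (λ i → W j i))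
        ≈⟨ +-cong (trans (sym (*-distribˡ-sum (fromℤ scale) (λ j → X j ^ (2 ℕ.+ k)))) (*-congˡ (sym (moment≈ (2 ℕ.+ k)))))
             (trans (∑-comm W) (trans (sum-cong-≋ {d} (λ i → sum-weightedPowers {2 ℕ.+ k} {e} design i powers pythagorean))
               (sum-const d _))) ⟩
      fromℤ scale * moment (2 ℕ.+ k) + fromℤ (+ d) * (fromℤ T * moment (2 ℕ.+ k))
        ≈⟨ solve 4 (λ s d t m → s :* m :+ d :* (t :* m) := (s :+ d :* t) :* m) refl
             (fromℤ scale) (fromℤ (+ d)) (fromℤ T) (moment (2 ℕ.+ k)) ⟩
      (fromℤ scale + fromℤ (+ d) * fromℤ T) * moment (2 ℕ.+ k)
        ≈⟨ *-congʳ (sym (trans (fromℤ-+ scale (+ d ℤ.* T)) (+-congˡ (fromℤ-* (+ d) T)))) ⟩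
      fromℤ (scale ℤ.+ + d ℤ.* T) * moment (2 ℕ.+ k) ∎
      where
      open PowerIdentity I
      T = totalWeight (2 ℕ.+ k) powers
      X : Fin N → Carrier
      X j = pt C j zero
      Y : Fin N → Fin d → Carrier
      Y j i = pt C j (suc i)
      W : Fin N → Fin d → Carrier
      W j i = weightedPowers (2 ℕ.+ k) powers (X j) (Y j i)
      expand : ∀ j → fromℤ scale * X j ^ k ≈ fromℤ scale * X j ^ (2 ℕ.+ k) + sum (λ i → W j i)
      expand j = begin
        fromℤ scale * X j ^ k
          ≈⟨ sym (*-identityʳ _) ⟩
        fromℤ scale * X j ^ k * 1#
          ≈⟨ *-congˡ (sym (unit (Injection.to C j))) ⟩
        fromℤ scale * X j ^ k * (X j * X j + sum (λ i → Y j i * Y j i))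
          ≈⟨ solve 4 (λ s x xk t → s :* xk :* (x :* x :+ t) := s :* (x :* (x :* xk)) :+ s :* xk :* t) refl
               (fromℤ scale) (X j) (X j ^ k) (sum (λ i → Y j i * Y j i)) ⟩
        fromℤ scale * X j ^ (2 ℕ.+ k) + fromℤ scale * X j ^ k * sum (λ i → Y j i * Y j i)
          ≈⟨ +-congˡ (trans (*-distribˡ-sum (fromℤ scale * X j ^ k) (λ i → Y j i * Y j i))
               (sum-cong-≋ {d} λ i → trans (*-assoc _ _ _) (identity (X j) (Y j i)))) ⟩
        fromℤ scale * X j ^ (2 ℕ.+ k) + sum (λ i → W j i) ∎

  -- The weights solve the linear system obtained by comparing coefficients.

  identity₀ : PowerIdentity 0
  identity₀ = record
    { scale       = + 2
    ; powers      = ps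
    ; pythagorean = ≡.refl ∷ []
    ; identity    = solve 2 (λ x y → con (+ 2) :* (x :^ 0 :* (y :* y)) := :weightedPowers 2 ps x y) refl
    }
    where
    ps = + 1 ∙[ 0 , 1 , 1 ]
       ∷ []

  -- Adding the two signs of q cancels the odd powers of y. Degree 4 then leaves three coefficients
  -- to match with three pairs; each later identity has one more of both.
  identity₂ : PowerIdentity 2
  identity₂ = record
    { scale       = + 1728
    ; powers      = ps
    ; pythagorean = ≡.refl ∷ ≡.refl ∷ ≡.refl ∷ []
    ; identity    = solve 2 (λ x y → con (+ 1728) :* (x :^ 2 :* (y :* y)) := :weightedPowers 4 ps x y) refl
    }
    where
    ps = ℤ.- + 81 ∙[ 1 , 0 , 1 ]
       ∷ ℤ.- + 256 ∙[ 0 , 1 , 1 ]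
       ∷ + 1 ∙[ 3 , 4 , 5 ]
       ∷ []

  identity₄ : PowerIdentity 4
  identity₄ = record
    { scale       = + 756000
    ; powers      = ps
    ; pythagorean = ≡.refl ∷ ≡.refl ∷ ≡.refl ∷ ≡.refl ∷ []
    ; identity    = solve 2 (λ x y → con (+ 756000) :* (x :^ 4 :* (y :* y)) := :weightedPowers 6 ps x y) refl
    }
    where
    ps = ℤ.- + 58975 ∙[ 1 , 0 , 1 ]
       ∷ + 25200 ∙[ 0 , 1 , 1 ]
       ∷ ℤ.- + 9 ∙[ 3 , 4 , 5 ]
       ∷ + 16 ∙[ 4 , 3 , 5 ]
       ∷ []

  identity₆ : PowerIdentity 6
  identity₆ = record
    { scale       = + 2607897600
    ; powers      = ps
    ; pythagorean = ≡.refl ∷ ≡.refl ∷ ≡.refl ∷ ≡.refl ∷ ≡.refl ∷ []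
    ; identity    = solve 2 (λ x y → con (+ 2607897600) :* (x :^ 6 :* (y :* y)) := :weightedPowers 8 ps x y) refl
    }
    where
    ps = ℤ.- + 117070800 ∙[ 1 , 0 , 1 ]
       ∷ ℤ.- + 268240896 ∙[ 0 , 1 , 1 ]
       ∷ ℤ.- + 2673 ∙[ 3 , 4 , 5 ]
       ∷ + 2048 ∙[ 4 , 3 , 5 ]
       ∷ + 1 ∙[ 5 , 12 , 13 ]
       ∷ []

  identity₈ : PowerIdentity 8
  identity₈ = record
    { scale       = + 84290510304000
    ; powers      = ps
    ; pythagorean = ≡.refl ∷ ≡.refl ∷ ≡.refl ∷ ≡.refl ∷ ≡.refl ∷ ≡.refl ∷ []
    ; identity    = solve 2 (λ x y → con (+ 84290510304000) :* (x :^ 8 :* (y :* y)) := :weightedPowers 10 ps x y) refl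
    }
    where
    ps = ℤ.- + 7749003518256 ∙[ 1 , 0 , 1 ]
       ∷ + 936561225600 ∙[ 0 , 1 , 1 ]
       ∷ + 646425 ∙[ 3 , 4 , 5 ]
       ∷ ℤ.- + 1149200 ∙[ 4 , 3 , 5 ]
       ∷ ℤ.- + 25 ∙[ 5 , 12 , 13 ]
       ∷ + 144 ∙[ 12 , 5 , 13 ]
       ∷ []

  -- The linear programming bound

  fromℤ-sub : ∀ i j → fromℤ (i ℤ.- j) ≈ fromℤ i - fromℤ j
  fromℤ-sub i j = trans (fromℤ-+ i (ℤ.- j)) (+-congˡ (fromℤ-neg j))

  rootProduct : List ℤ → Carrier → Carrier
  rootProduct []       u = fromℤ (+ 1)
  rootProduct (r ∷ rs) u = (u - fromℤ r) * rootProduct rs u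

  rootProduct-cong : ∀ rs {u v} → u ≈ v → rootProduct rs u ≈ rootProduct rs v
  rootProduct-cong []       u≈v = refl
  rootProduct-cong (r ∷ rs) u≈v = *-cong (+-congʳ u≈v) (rootProduct-cong rs u≈v)

  rootProduct-fromℤ : ∀ rs s → rootProduct rs (fromℤ s) ≈ fromℤ (rootProductℤ rs s)
  rootProduct-fromℤ []       s = refl
  rootProduct-fromℤ (r ∷ rs) s = sym (trans (fromℤ-* (s ℤ.- r) (rootProductℤ rs s))
    (*-cong (fromℤ-sub s r) (sym (rootProduct-fromℤ rs s))))

  root⇒rootProduct≈0 : ∀ {rs u} → Any (λ r → u ≈ fromℤ r) rs → rootProduct rs u ≈ 0#
  root⇒rootProduct≈0 (here u≈r)   = trans (*-congʳ (trans (+-congʳ u≈r) (-‿inverseʳ _))) (zeroˡ _)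
  root⇒rootProduct≈0 (there root) = trans (*-congˡ (root⇒rootProduct≈0 root)) (zeroʳ _)

  rootProduct≈0⇒root : ∀ rs {u} → rootProduct rs u ≈ 0# → Any (λ r → u ≈ fromℤ r) rs
  rootProduct≈0⇒root []       1≈0 = contradiction 1≈0 (fromℤ-nonzero λ ())
  rootProduct≈0⇒root (r ∷ rs) {u} Π≈0 with x*y≈0⇒x≈0∨y≈0 (u - fromℤ r) (rootProduct rs u) Π≈0
  ... | inj₁ u-r≈0 = here (x-y≈0⇒x≈y u-r≈0)
  ... | inj₂ Π′≈0  = there (rootProduct≈0⇒root rs Π′≈0)

  module _ {N : ℕ} (u : Vector Carrier N) (D : Carrier) (n : Carrier) (c : ℕ → ℤ) (τ : ℕ)
           (moments : ∀ k → k ℕ.≤ τ → D * sum (λ j → u j ^ k) ≈ fromℤ (c k) * n) where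

    -- The factor u ^ k is carried along because splitting off a root r leads to the sums at suc k
    -- and at k, which is the recursion of `functional`.
    sum-power*rootProduct : ∀ rs k → k ℕ.+ length rs ℕ.≤ τ →
      D * sum (λ j → u j ^ k * rootProduct rs (u j)) ≈ fromℤ (functional c k rs) * n
    sum-power*rootProduct [] k k≤τ = trans
      (*-congˡ (sum-cong-≋ {N} λ j → trans (*-congˡ fromℤ-1) (*-identityʳ _)))
      (moments k (≡.subst (ℕ._≤ τ) (ℕ.+-identityʳ k) k≤τ))
    sum-power*rootProduct (r ∷ rs) k k+l≤τ = begin
      D * sum (λ j → u j ^ k * ((u j - fromℤ r) * rootProduct rs (u j)))
        ≈⟨ *-congˡ (sum-cong-≋ {N} λ j → solve 4 (λ uᵏ u r Π → uᵏ :* ((u :- r) :* Π) := u :* uᵏ :* Π :+ :- r :* (uᵏ :* Π))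
             refl (u j ^ k) (u j) (fromℤ r) (rootProduct rs (u j))) ⟩
      D * sum (λ j → f (suc k) j + - fromℤ r * f k j)
        ≈⟨ *-congˡ (trans (∑-distrib-+ (f (suc k)) (λ j → - fromℤ r * f k j))
             (+-congˡ (sym (*-distribˡ-sum (- fromℤ r) (f k))))) ⟩
      D * (sum (f (suc k)) + - fromℤ r * sum (f k))
        ≈⟨ solve 4 (λ D r p q → D :* (p :+ :- r :* q) := D :* p :- r :* (D :* q)) refl
             D (fromℤ r) (sum (f (suc k))) (sum (f k)) ⟩
      D * sum (f (suc k)) - fromℤ r * (D * sum (f k))
        ≈⟨ +-cong (sum-power*rootProduct rs (suc k) suc-k+l≤τ)
             (-‿cong (*-congˡ (sum-power*rootProduct rs k (ℕ.≤-trans (ℕ.n≤1+n _) suc-k+l≤τ)))) ⟩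
      fromℤ (functional c (suc k) rs) * n - fromℤ r * (fromℤ (functional c k rs) * n)
        ≈⟨ solve 4 (λ p r q n → p :* n :- r :* (q :* n) := (p :- r :* q) :* n) refl
             (fromℤ (functional c (suc k) rs)) (fromℤ r) (fromℤ (functional c k rs)) n ⟩
      (fromℤ (functional c (suc k) rs) - fromℤ r * fromℤ (functional c k rs)) * n
        ≈⟨ *-congʳ (sym (trans (fromℤ-sub (functional c (suc k) rs) (r ℤ.* functional c k rs))
             (+-congˡ (-‿cong (fromℤ-* r (functional c k rs)))))) ⟩
      fromℤ (functional c k (r ∷ rs)) * n ∎
      where
      f : ℕ → Vector Carrier N
      f k j = u j ^ k * rootProduct rs (u j)
      suc-k+l≤τ : suc k ℕ.+ length rs ℕ.≤ τ
      suc-k+l≤τ = ≡.subst (ℕ._≤ τ) (ℕ.+-suc k (length rs)) k+l≤τ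

    sum-rootProduct : ∀ rs → length rs ℕ.≤ τ →
      D * sum (λ j → rootProduct rs (u j)) ≈ fromℤ (functional c 0 rs) * n
    sum-rootProduct rs l≤τ = trans
      (*-congˡ (sum-cong-≋ {N} λ j → sym (*-identityˡ _))) (sum-power*rootProduct rs 0 l≤τ)

  -- Turns a sum of a function with values v and 0 into a count. The general `tabulate f` allows the
  -- induction to shift f; `allFin` is the case of the identity.
  sum-filter : ∀ {n} {X : Set} {P : Pred X 0ℓ} (P? : Decidable P) (f : Fin n → X) (h : X → Carrier) v →
    (∀ {x} → P x → h x ≈ v) → (∀ {x} → ¬ P x → h x ≈ 0#) →
    sum (λ i → h (f i)) ≈ fromℤ (+ length (filter P? (tabulate f))) * v
  sum-filter {zero}  P? f h v P⇒v ¬P⇒0 = sym (trans (*-congʳ fromℤ-0) (zeroˡ v))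
  sum-filter {suc n} P? f h v P⇒v ¬P⇒0 with P? (f zero)
  ... | yes p = begin
    h (f zero) + sum (λ i → h (f (suc i)))  ≈⟨ +-cong (P⇒v p) (sum-filter P? (f ∘ suc) h v P⇒v ¬P⇒0) ⟩
    v + fromℤ (+ l) * v                     ≈⟨ solve 2 (λ v l → v :+ l :* v := (con (+ 1) :+ l) :* v) refl v (fromℤ (+ l)) ⟩
    (fromℤ (+ 1) + fromℤ (+ l)) * v         ≈⟨ *-congʳ (sym (fromℤ-+ (+ 1) (+ l))) ⟩
    fromℤ (+ suc l) * v                     ∎
    where l = length (filter P? (tabulate (f ∘ suc)))
  ... | no ¬p = trans (+-cong (¬P⇒0 ¬p) (sum-filter P? (f ∘ suc) h v P⇒v ¬P⇒0)) (+-identityˡ _)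

  six : Carrier
  six = fromℤ (+ 6)

  six-cancel : ∀ {x y} → six * x ≈ six * y → x ≈ y
  six-cancel = *-cancelˡ (fromℤ-nonzero λ ())

  0≤six : 0# ≤ six
  0≤six = inj₁ (fromℤ-positive (ℤ.+<+ (s≤s z≤n)))

  six*1/ : ∀ k l → k ℕ.* suc l ≡ 6 → six * 1/ suc l ≈ fromℤ (+ k)
  six*1/ k l k*l≡6 = begin
    six * 1/ suc l                            ≈⟨ *-congʳ (fromℤ-cong-≡ (≡.trans (≡.cong +_ (≡.sym k*l≡6)) (ℤ.pos-* k (suc l)))) ⟩
    fromℤ (+ k ℤ.* + suc l) * 1/ suc l        ≈⟨ trans (*-congʳ (fromℤ-* (+ k) (+ suc l))) (*-assoc _ _ _) ⟩
    fromℤ (+ k) * (fromℤ (+ suc l) * 1/ suc l) ≈⟨ *-congˡ (trans (*-congʳ (fromℤ-pos (suc l))) (⁻¹-inverse _ λ l≈0 → ℕ.1+n≢0 (ι≈0⇒≡0 (suc l) l≈0))) ⟩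
    fromℤ (+ k) * 1#                          ≈⟨ *-identityʳ _ ⟩
    fromℤ (+ k)                               ∎

  six*-1/ : ∀ k l → k ℕ.* suc l ≡ 6 → six * - (1/ suc l) ≈ fromℤ (ℤ.- + k)
  six*-1/ k l k*l≡6 = trans (solve 2 (λ s x → s :* :- x := :- (s :* x)) refl six (1/ suc l))
    (trans (-‿cong (six*1/ k l k*l≡6)) (sym (fromℤ-neg (+ k))))

  six*1 : six * 1# ≈ fromℤ (+ 6)
  six*1 = *-identityʳ six

  six*-1 : six * - 1# ≈ fromℤ (ℤ.- + 6)
  six*-1 = trans (solve 2 (λ s x → s :* :- x := :- (s :* x)) refl six 1#)
    (trans (-‿cong six*1) (sym (fromℤ-neg (+ 6))))

  six*0 : six * 0# ≈ fromℤ (+ 0)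
  six*0 = trans (zeroʳ six) (sym fromℤ-0)

  double-root-nonneg : ∀ x {p} → 0# ≤ p → 0# ≤ x * (x * p)
  double-root-nonneg x {p} 0≤p = ≤-respʳ-≈ (*-assoc x x p) (*-nonneg (square-nonneg x) 0≤p)

  -- The factors are taken in the order of `extremalRoots`: three double roots, then the pairs (-2 ,
  -- -1) and (1 , 2), whose open intervals are the scaled parts of `F`, and last u + 6, nonnegative
  -- because t ≥ -1.
  extremal-nonneg : ∀ {t} → - 1# ≤ t → t ∉ F → 0# ≤ rootProduct extremalRoots (six * t)
  extremal-nonneg {t} -1≤t t∉F =
    double-root-nonneg _ (double-root-nonneg _ (double-root-nonneg _
      (pair (outside (ℤ.-<- ℕ.≤-refl) λ (-2<u , u<-1) → t∉F (inj₁
          ( *-cancelˡ-< 0≤six (<-respˡ (sym (six*-1/ 2 2 ≡.refl)) -2<u)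
          , *-cancelˡ-< 0≤six (<-respʳ (sym (six*-1/ 1 5 ≡.refl)) u<-1))))
      (pair (outside (ℤ.+<+ ℕ.≤-refl) λ (1<u , u<2) → t∉F (inj₂
          ( *-cancelˡ-< 0≤six (<-respˡ (sym (six*1/ 1 5 ≡.refl)) 1<u)
          , *-cancelˡ-< 0≤six (<-respʳ (sym (six*1/ 2 2 ≡.refl)) u<2))))
      (*-nonneg (x≤y⇒0≤y-x (≤-respˡ-≈ six*-1 (*-monoˡ-≤ 0≤six -1≤t)))
        (inj₁ (fromℤ-positive (ℤ.+<+ (s≤s z≤n)))))))))
    where
    outside : ∀ {a b} → a ℤ.< b → ¬ (fromℤ a < six * t × six * t < fromℤ b) →
              0# ≤ (six * t - fromℤ a) * (six * t - fromℤ b)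
    outside a<b = outside-interval (fromℤ-mono-< a<b)
    pair : ∀ {x y p} → 0# ≤ x * y → 0# ≤ p → 0# ≤ x * (y * p)
    pair {x} {y} {p} 0≤xy 0≤p = ≤-respʳ-≈ (*-assoc x y p) (*-nonneg 0≤xy 0≤p)

  -- Here and in Tight the scale D is a variable, because conversion checking
  -- unfolds a product with a large literal.

  module _ {d N : ℕ} (C : Code d N) (i : Fin N) (u : Vector Carrier N) (D : ℤ) (f : ℤ) (rs : List ℤ)
           {s : ℤ} {t : Carrier}
           (at-s  : ∀ {j} → ⟨ pt C i , pt C j ⟩ ≈ t → u j ≈ fromℤ s)
           (off-s : ∀ {j} → ¬ (⟨ pt C i , pt C j ⟩ ≈ t) → Any (λ r → u j ≈ fromℤ r) rs)
           where

    -- The polynomial vanishes at every point whose product with the i-th point is not t and takes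
    -- one constant value at the others, so its sum is a multiple of the count.
    count-equation : fromℤ D * sum (λ j → rootProduct rs (u j)) ≈ fromℤ f →
                     + A C t i ℤ.* (D ℤ.* rootProductℤ rs s) ≡ f
    count-equation DΣ≈f = fromℤ-injective (begin
      fromℤ (+ A C t i ℤ.* (D ℤ.* p))
        ≈⟨ trans (fromℤ-* (+ A C t i) (D ℤ.* p)) (*-congˡ (fromℤ-* D p)) ⟩
      fromℤ (+ A C t i) * (fromℤ D * fromℤ p)
        ≈⟨ solve 3 (λ a D p → a :* (D :* p) := D :* (a :* p)) refl (fromℤ (+ A C t i)) (fromℤ D) (fromℤ p) ⟩
      fromℤ D * (fromℤ (+ A C t i) * fromℤ p)
        ≈⟨ *-congˡ (sym (sum-filter (λ j → ⟨ pt C i , pt C j ⟩ ≟ t) (λ j → j) (λ j → rootProduct rs (u j)) (fromℤ p)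
             (λ p≈t → trans (rootProduct-cong rs (at-s p≈t)) (rootProduct-fromℤ rs s))
             (λ p≉t → root⇒rootProduct≈0 (off-s p≉t)))) ⟩
      fromℤ D * sum (λ j → rootProduct rs (u j))  ≈⟨ DΣ≈f ⟩
      fromℤ f ∎)
      where p = rootProductℤ rs s

  module _ {d N : ℕ} (C : Code d N) where

    scaledProduct : Fin N → Fin N → Carrier
    scaledProduct i j = six * ⟨ pt C i , pt C j ⟩

    scaledProduct-self : ∀ i → scaledProduct i i ≈ fromℤ (+ 6)
    scaledProduct-self i = trans (*-congˡ (unit (Injection.to C i))) six*1

  -- Moments of an 11-design in dimension 48

  module _ {N : ℕ} .{{_ : NonZero N}} (C : Code 47 N) (design : IsDesign C 11) where

    private
      n D : Carrier
      n = fromℤ (+ N)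
      D = fromℤ commonDenominator

    -- The tabulated moments obey the same recurrence as those of the design, and the factor L
    -- cancels. The 47 counts the coordinates other than the first.
    moment-step : ∀ {k e} → IsDesign C (2 ℕ.+ k ℕ.+ e) → (I : PowerIdentity k) →
      let open PowerIdentity I
          L = scale ℤ.+ + 47 ℤ.* totalWeight (2 ℕ.+ k) powers in
      L ≢ + 0 →
      coordinateMoment (2 ℕ.+ k) ℤ.* L ≡ scale ℤ.* coordinateMoment k →
      D * moment C k ≈ fromℤ (coordinateMoment k) * n →
      D * moment C (2 ℕ.+ k) ≈ fromℤ (coordinateMoment (2 ℕ.+ k)) * n
    moment-step {k} {e} design′ I L≢0 μ′L≡sμ Dm≈μn = *-cancelˡ (fromℤ-nonzero L≢0) (begin
      fromℤ L * (D * m′)          ≈⟨ x*[y*z]≈y*[x*z] _ _ _ ⟩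
      D * (fromℤ L * m′)          ≈⟨ *-congˡ (sym (moment-recurrence C {k} {e} design′ I)) ⟩
      D * (fromℤ scale * moment C k) ≈⟨ x*[y*z]≈y*[x*z] _ _ _ ⟩
      fromℤ scale * (D * moment C k) ≈⟨ trans (*-congˡ Dm≈μn) (sym (*-assoc _ _ _)) ⟩
      fromℤ scale * fromℤ (coordinateMoment k) * n
        ≈⟨ *-congʳ (sym (fromℤ-* scale (coordinateMoment k))) ⟩
      fromℤ (scale ℤ.* coordinateMoment k) * n ≈⟨ *-congʳ (fromℤ-cong-≡ (≡.sym μ′L≡sμ)) ⟩
      fromℤ (μ′ ℤ.* L) * n        ≈⟨ *-congʳ (trans (fromℤ-* μ′ L) (*-comm _ _)) ⟩
      fromℤ L * fromℤ μ′ * n      ≈⟨ *-assoc _ _ _ ⟩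
      fromℤ L * (fromℤ μ′ * n)    ∎)
      where
      open PowerIdentity I
      L = scale ℤ.+ + 47 ℤ.* totalWeight (2 ℕ.+ k) powers
      m′ = moment C (2 ℕ.+ k)
      μ′ = coordinateMoment (2 ℕ.+ k)
      x*[y*z]≈y*[x*z] : ∀ x y z → x * (y * z) ≈ y * (x * z)
      x*[y*z]≈y*[x*z] = solve 3 (λ x y z → x :* (y :* z) := y :* (x :* z)) refl

    odd-moment : ∀ {m} → m ≈ 0# → D * m ≈ fromℤ (+ 0) * n
    odd-moment m≈0 = trans (*-congˡ m≈0) (trans (zeroʳ D) (sym (trans (*-congʳ fromℤ-0) (zeroˡ n))))

    moment-value : ∀ k → k ℕ.≤ 11 → D * moment C k ≈ fromℤ (coordinateMoment k) * n
    moment-value 0 _ = *-congˡ (moment-0 C)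
    -- The implicit arguments split the strength: 2 + k + e = 11 here, k + e = 11 for the odd
    -- moments.
    moment-value 2 _ = moment-step {0} {9} design identity₀ (λ ()) ≡.refl (moment-value 0 z≤n)
    moment-value 4 _ = moment-step {2} {7} design identity₂ (λ ()) ≡.refl (moment-value 2 (ℕ.m≤m+n 2 9))
    moment-value 6 _ = moment-step {4} {5} design identity₄ (λ ()) ≡.refl (moment-value 4 (ℕ.m≤m+n 4 7))
    moment-value 8 _ = moment-step {6} {3} design identity₆ (λ ()) ≡.refl (moment-value 6 (ℕ.m≤m+n 6 5))
    moment-value 10 _ = moment-step {8} {1} design identity₈ (λ ()) ≡.refl (moment-value 8 (ℕ.m≤m+n 8 3))
    moment-value 1 _ = odd-moment (moment-odd C {1} {10} design ≡.refl)
    moment-value 3 _ = odd-moment (moment-odd C {3} {8} design ≡.refl)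
    moment-value 5 _ = odd-moment (moment-odd C {5} {6} design ≡.refl)
    moment-value 7 _ = odd-moment (moment-odd C {7} {4} design ≡.refl)
    moment-value 9 _ = odd-moment (moment-odd C {9} {2} design ≡.refl)
    moment-value 11 _ = odd-moment (moment-odd C {11} {0} design ≡.refl)
    moment-value (suc (suc (suc (suc (suc (suc (suc (suc (suc (suc (suc (suc k)))))))))))) k≤11 =
      contradiction k≤11 (ℕ.m+1+n≰m 11)

    -- Six times a point of C has the norm of six times the first basis vector. The sum is therefore
    -- independent of i, which is the source of distance invariance.
    sum-scaledProduct : ∀ i k → k ℕ.≤ 11 →
      D * sum (λ j → scaledProduct C i j ^ k) ≈ fromℤ (scaledMoment k) * n
    sum-scaledProduct i k k≤11 = begin
      D * sum (λ j → scaledProduct C i j ^ k)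
        ≈⟨ *-congˡ (sum-cong-≋ {N} λ j → ^-congˡ k (sym (⟨⟩-scaleˡ six (pt C i) (pt C j)))) ⟩
      D * powerSum C k (λ l → six * pt C i l)
        ≈⟨ *-congˡ (powerSum-scaled-unit C {k} {11 ℕ.∸ k} (≡.subst (IsDesign C) (≡.sym (ℕ.m+[n∸m]≡n k≤11)) design)
             (+ 6) (pt C i) (unit (Injection.to C i))) ⟩
      D * (fromℤ ((+ 6) ℤ.^ k) * moment C k)
        ≈⟨ solve 3 (λ D s m → D :* (s :* m) := s :* (D :* m)) refl D (fromℤ ((+ 6) ℤ.^ k)) (moment C k) ⟩
      fromℤ ((+ 6) ℤ.^ k) * (D * moment C k)
        ≈⟨ trans (*-congˡ (moment-value k k≤11)) (sym (*-assoc _ _ _)) ⟩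
      fromℤ ((+ 6) ℤ.^ k) * fromℤ (coordinateMoment k) * n
        ≈⟨ *-congʳ (sym (fromℤ-* ((+ 6) ℤ.^ k) (coordinateMoment k))) ⟩
      fromℤ (scaledMoment k) * n ∎

    design-sum : ∀ i rs → length rs ℕ.≤ 11 →
      D * sum (λ j → rootProduct rs (scaledProduct C i j)) ≈ fromℤ (functional scaledMoment 0 rs ℤ.* + N)
    design-sum i rs l≤11 = trans
      (sum-rootProduct (scaledProduct C i) D n scaledMoment 11 (sum-scaledProduct i) rs l≤11)
      (sym (fromℤ-* (functional scaledMoment 0 rs) (+ N)))

  -- The bound and the case of equality

  -- In the application V is the value of the extremal polynomial at 6, and E / D
  -- is its mean.

  module Tight {d N : ℕ} .{{_ : NonZero N}} (C : Code d N) (D : ℤ) (c : ℕ → ℤ) (b : ℕ)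
           (design-sum : ∀ i rs → length rs ℕ.≤ 11 →
             fromℤ D * sum (λ j → rootProduct rs (scaledProduct C i j)) ≈ fromℤ (functional c 0 rs ℤ.* + N))
           (I⊆ : ∀ t → t ∈ InnerProducts C → (- 1# ≤ t) × (t < 1#) × (t ∉ F))
           (V E : ℤ) (V≡ : rootProductℤ extremalRoots (+ 6) ≡ V)
           (extremal-sum : ∀ i → fromℤ D * sum (λ j → rootProduct extremalRoots (scaledProduct C i j)) ≈ fromℤ (E ℤ.* + N))
           (0<D : + 0 ℤ.< D) (0<V : + 0 ℤ.< V) (0<E : + 0 ℤ.< E) (ratio : D ℤ.* V ≡ + b ℤ.* E)
           (equations : All (CountEquation D c b) distribution) where

    -- Once all scaled products are nodes, the Lagrange polynomial of s isolates the points at t.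
    -- The count then solves the same linear equation as the certified v.
    count-node : N ≡ b → ∀ i → (∀ j → Any (λ r → scaledProduct C i j ≈ fromℤ r) nodes) →
      ∀ {s v} → CountEquation D c b (s , v) → ∀ {t} → six * t ≈ fromℤ s → A C t i ≡ v
    count-node N≡bound i all-nodes {s} {v} (short , nonzero , equation) {t} 6t≈s =
      cancel-factor (D ℤ.* rootProductℤ (otherNodes s) s) (functional c 0 (otherNodes s))
        nonzero N≡bound
        (count-equation C i (scaledProduct C i) D
          (functional c 0 (otherNodes s) ℤ.* + N) (otherNodes s) at-s off-s
          (design-sum i (otherNodes s) short))
        equation
      where
      at-s : ∀ {j} → ⟨ pt C i , pt C j ⟩ ≈ t → scaledProduct C i j ≈ fromℤ s
      at-s p≈t = trans (*-congˡ p≈t) 6t≈s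
      off-s : ∀ {j} → ¬ (⟨ pt C i , pt C j ⟩ ≈ t) → Any (λ r → scaledProduct C i j ≈ fromℤ r) (otherNodes s)
      off-s {j} p≉t with ∈.find (all-nodes j)
      ... | r , r∈nodes , u≈r = ∈.lose (∈-filter⁺ (λ r → ¬? (r ℤ.≟ s)) r∈nodes r≢s) u≈r
        where
        r≢s : r ≢ s
        r≢s ≡.refl = p≉t (six-cancel (trans u≈r (sym 6t≈s)))

    -- A product equal to t would be a node; t < 1 excludes the node 6, and the hypothesis excludes
    -- the others.
    count-absent : ∀ i → (∀ j → Any (λ r → scaledProduct C i j ≈ fromℤ r) nodes) →
      ∀ t → t < 1# → ¬ Any (λ (s , _) → six * t ≈ fromℤ s) distribution → A C t i ≡ 0
    count-absent i all-nodes t t<1 ∉distribution = ≡.cong length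
      (filter-none (λ j → ⟨ pt C i , pt C j ⟩ ≟ t) (All.universal absent (allFin N)))
      where
      absent : ∀ j → ¬ (⟨ pt C i , pt C j ⟩ ≈ t)
      absent j p≈t with all-nodes j
      ... | here u≈6    = irrefl (six-cancel (trans (*-congˡ (sym p≈t)) (trans u≈6 (sym six*1)))) t<1
      ... | there u≈s = ∉distribution
        (Any.map (trans (*-congˡ (sym p≈t))) (Any.map⁻ u≈s))

    extremalRoot⇒node : ∀ {u} → Any (λ r → u ≈ fromℤ r) extremalRoots → Any (λ r → u ≈ fromℤ r) nodes
    extremalRoot⇒node root with ∈.find root
    ... | r , r∈roots , u≈r = ∈.lose (All.lookup extremalRoots⊆nodes r∈roots) u≈r

    extremalTerm : Fin N → Fin N → Carrier
    extremalTerm i j = rootProduct extremalRoots (scaledProduct C i j)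

    extremalTerm-self : ∀ i → extremalTerm i i ≈ fromℤ V
    extremalTerm-self i = trans (rootProduct-cong extremalRoots (scaledProduct-self C i))
      (trans (rootProduct-fromℤ extremalRoots (+ 6)) (fromℤ-cong-≡ V≡))

    extremalTerm-nonneg : ∀ i j → 0# ≤ extremalTerm i j
    extremalTerm-nonneg i j with i Fin.≟ j
    ... | yes ≡.refl = ≤-respʳ-≈ (sym (extremalTerm-self i)) (inj₁ (fromℤ-positive 0<V))
    ... | no  i≢j =
      let -1≤t , _ , t∉F = I⊆ ⟨ pt C i , pt C j ⟩ (i , j , i≢j , refl) in extremal-nonneg -1≤t t∉F

    -- The sum of nonnegative terms is at least the term V of the point itself. Hence D V ≤ E N, and
    -- D V = b E lets E cancel.
    bound≤N : b ℕ.≤ N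
    bound≤N = ℤ.drop‿+≤+ (ℤ.*-cancelʳ-≤-pos (+ b) (+ N) E {{ℤ.positive 0<E}}
      (≡.subst₂ ℤ._≤_ ratio (ℤ.*-comm E (+ N)) (fromℤ-cancel-≤ Df≤EN)))
      where
      -- Any point of C would serve; the first exists because N is nonzero.
      i = fromℕ< (ℕ.>-nonZero⁻¹ N)
      Df≤EN : fromℤ (D ℤ.* V) ≤ fromℤ (E ℤ.* + N)
      Df≤EN = ≤-respˡ-≈ (sym (fromℤ-* D V))
        (≤-respʳ-≈ (extremal-sum i)
          (*-monoˡ-≤ (inj₁ (fromℤ-positive 0<D))
            (≤-respˡ-≈ (extremalTerm-self i) (term≤sum (extremalTerm i) (extremalTerm-nonneg i) i))))

    -- For N = b the term of the point itself already equals the whole sum, so all other terms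
    -- vanish and their products are roots of the extremal polynomial.
    tight-nodes : N ≡ b → ∀ i j → Any (λ r → scaledProduct C i j ≈ fromℤ r) nodes
    tight-nodes N≡bound i j with i Fin.≟ j
    ... | yes ≡.refl = here (scaledProduct-self C i)
    ... | no  i≢j = extremalRoot⇒node (rootProduct≈0⇒root extremalRoots
      (sum≈term⇒others≈0 (extremalTerm i) (extremalTerm-nonneg i) Σ≈self i≢j))
      where
      Σ≈self : sum (extremalTerm i) ≈ extremalTerm i i
      Σ≈self = *-cancelˡ (fromℤ-nonzero {D} λ { ≡.refl → ℤ.<-irrefl ≡.refl 0<D }) (begin
        fromℤ D * sum (extremalTerm i)  ≈⟨ extremal-sum i ⟩
        fromℤ (E ℤ.* + N)
          ≈⟨ fromℤ-cong-≡ (≡.trans (≡.cong (λ m → E ℤ.* + m) N≡bound) (≡.trans (ℤ.*-comm E (+ b)) (≡.sym ratio))) ⟩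
        fromℤ (D ℤ.* V)                 ≈⟨ fromℤ-* D V ⟩
        fromℤ D * fromℤ V               ≈⟨ *-congˡ (sym (extremalTerm-self i)) ⟩
        fromℤ D * extremalTerm i i      ∎)

    count : N ≡ b → ∀ {s v} → (s , v) ∈ₗ distribution → ∀ {t} → six * t ≈ fromℤ s → ∀ i → A C t i ≡ v
    count N≡bound sv∈ 6t≈s i =
      count-node N≡bound i (tight-nodes N≡bound i) (All.lookup equations sv∈) 6t≈s

    distance-invariant : N ≡ b → DistanceInvariant C
    distance-invariant N≡bound t _ t<1 i j with any? (λ (s , _) → six * t ≟ fromℤ s) distribution
    ... | no  ∉distribution = ≡.trans (count-absent i (tight-nodes N≡bound i) t t<1 ∉distribution)
      (≡.sym (count-absent j (tight-nodes N≡bound j) t t<1 ∉distribution))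
    ... | yes ∈distribution with ∈.find ∈distribution
    ...   | _ , sv∈ , 6t≈s = ≡.trans (count N≡bound sv∈ 6t≈s i) (≡.sym (count N≡bound sv∈ 6t≈s j))

    absent : N ≡ b → ∀ i t → t < 1# → ¬ Any (λ (s , _) → six * t ≈ fromℤ s) distribution → A C t i ≡ 0
    absent N≡b i = count-absent i (tight-nodes N≡b i)

theorem6 : (ℝ : CompleteOrderedField) → let open Spherical ℝ in
    (N : ℕ) .{{_ : NonZero N}} (C : Code 47 N) →
    IsDesign C 11 →
    (∀ t → t ∈ InnerProducts C → (- 1# ≤ t) × (t < 1#) × (t ∉ F)) →
    (52416000 ℕ.≤ N) ×
    (N ≡ 52416000 →
    DistanceInvariant C ×
    (∀ i →
    (A C (- 1#) i ≡ 1) ×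
    (A C (1/ 2) i ≡ 36848) × (A C (- (1/ 2)) i ≡ 36848) ×
    (A C (1/ 3) i ≡ 1678887) × (A C (- (1/ 3)) i ≡ 1678887) ×
    (A C (1/ 6) i ≡ 12608784) × (A C (- (1/ 6)) i ≡ 12608784) ×
    (A C 0# i ≡ 23766960) ×
    (∀ t → - 1# ≤ t → t < 1# →
    ¬ (t ≈ - 1#) →
    ¬ (t ≈ 1/ 2) → ¬ (t ≈ - (1/ 2)) →
    ¬ (t ≈ 1/ 3) → ¬ (t ≈ - (1/ 3)) →
    ¬ (t ≈ 1/ 6) → ¬ (t ≈ - (1/ 6)) →
    ¬ (t ≈ 0#) →
    A C t i ≡ 0)))
theorem6 ℝ N C design I⊆ = bound≤N , λ N≡bound →
  distance-invariant N≡bound , λ i →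
    count N≡bound (here ≡.refl) six*-1 i ,
    count N≡bound (there (here ≡.refl)) (six*1/ 3 1 ≡.refl) i ,
    count N≡bound (there (there (here ≡.refl))) (six*-1/ 3 1 ≡.refl) i ,
    count N≡bound (there (there (there (here ≡.refl)))) (six*1/ 2 2 ≡.refl) i ,
    count N≡bound (there (there (there (there (here ≡.refl))))) (six*-1/ 2 2 ≡.refl) i ,
    count N≡bound (there (there (there (there (there (here ≡.refl)))))) (six*1/ 1 5 ≡.refl) i ,
    count N≡bound (there (there (there (there (there (there (here ≡.refl))))))) (six*-1/ 1 5 ≡.refl) i ,
    count N≡bound (there (there (there (there (there (there (there (here ≡.refl)))))))) six*0 i ,
    λ t _ t<1 t≉-1 t≉1/2 t≉-1/2 t≉1/3 t≉-1/3 t≉1/6 t≉-1/6 t≉0 → absent N≡bound i t t<1 λ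
      { (here e) → t≉-1 (same e six*-1)
      ; (there (here e)) → t≉1/2 (same e (six*1/ 3 1 ≡.refl))
      ; (there (there (here e))) → t≉-1/2 (same e (six*-1/ 3 1 ≡.refl))
      ; (there (there (there (here e)))) → t≉1/3 (same e (six*1/ 2 2 ≡.refl))
      ; (there (there (there (there (here e))))) → t≉-1/3 (same e (six*-1/ 2 2 ≡.refl))
      ; (there (there (there (there (there (here e)))))) → t≉1/6 (same e (six*1/ 1 5 ≡.refl))
      ; (there (there (there (there (there (there (here e))))))) → t≉-1/6 (same e (six*-1/ 1 5 ≡.refl))
      ; (there (there (there (there (there (there (there (here e)))))))) → t≉0 (same e six*0)
      }
  where
  open Spherical ℝ using (_≈_; _*_; sym; trans)
  open SphericalDesigns ℝ
  open Tight C commonDenominator scaledMoment bound (design-sum C design) I⊆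
    extremalValue (functional scaledMoment 0 extremalRoots) ≡.refl
    -- The extremal polynomial has degree 11, the full strength of the design.
    (λ i → design-sum C design i extremalRoots (ℕ.m≤m+n 11 0))
    (ℤ.+<+ (s≤s z≤n)) (ℤ.+<+ (s≤s z≤n)) (ℤ.+<+ (s≤s z≤n)) extremal-ratio countEquations
  same : ∀ {x y z} → six * x ≈ z → six * y ≈ z → x ≈ y
  same 6x≈z 6y≈z = six-cancel (trans 6x≈z (sym 6y≈z))
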